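{- For any real-valued function $r(N)$ of the positive integer $N$ with $\lim_{N\to\infty}r(N)=\infty$ we have $$E_N^{lin-exp-sym}\ge 2^{N/2-r(N)+o(1)}.$$ Moreover, we have $$E_N^{lin-sym}\ge\frac{N}{2}-\log(N)+o(1).$$ Here $o(1)$ denotes a function of $N$ tending to $0$ as $N\to\infty$ (in the first bound it may depend on the function $r$).
   Context: For a binary vector $\mathcal{S}_N=(s_0,\ldots,s_{N-1})\in\{0,1\}^N$, regarded over the field $\mathbb{F}_2$, the $N$th linear complexity $L(\mathcal{S}_N)$ is the smallest integer $L\ge 0$ for which there are $c_0,\ldots,c_L\in\mathbb{F}_2$ with $c_L=1$ such that $$\sum_{\ell=0}^L c_\ell s_{n+\ell}=0,\quad n=0,1,\ldots,N-L-1$$ (the condition is vacuous for $L=N$; the zero vector has $L=0$). The reverse of $\mathcal{S}_N$ is $\mathcal{S}_N^{rev}=(s_{N-1},s_{N-2},\ldots,s_0)$ and the $N$th symmetric linear complexity is $L^{sym}(\mathcal{S}_N)=\min\{L(\mathcal{S}_N),L(\mathcal{S}_N^{rev})\}$. The expected values are $$E_N^{lin-sym}=2^{ -N}\sum_{\mathcal{S}_N\in\{0,1\}^N}L^{sym}(\mathcal{S}_N),\qquad E_N^{lin-exp-sym}=2^{ -N}\sum_{\mathcal{S}_N\in\{0,1\}^N}2^{L^{sym}(\mathcal{S}_N)}.$$ $\log$ denotes the natural logarithm. -}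

module Defs where

open import Algebra.Bundles using (CommutativeRing)
open import Data.Bool.Base using (Bool; true; false)
open import Data.Bool.Properties as Bool using (xor-∧-commutativeRing)
open import Data.Empty using (⊥)
open import Data.Fin.Base using (Fin; toℕ; fromℕ; fromℕ<)
open import Data.Fin.Properties using (all?; toℕ<n; toℕ≤pred[n])
open import Data.Fin.Subset.Properties using (anySubset?)
open import Data.Integer.Base as ℤ using (ℤ; +_; -[1+_])
import Data.Integer.Properties as ℤ
import Data.Integer.Solver as ℤ
open import Data.Nat.Base as ℕ using (ℕ; zero; suc; pred; NonZero; s≤s; z≤n)
import Data.Nat.Properties as ℕ
import Data.Nat.Solver as ℕ
open import Data.Product.Base using (Σ; ∃; ∃₂; Σ-syntax; ∃-syntax; _×_; _,_; proj₁; proj₂)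
open import Data.Rational.Base as ℚ
  using (ℚ; mkℚ; _/_; 0ℚ; 1ℚ; ½; _+_; _*_; -_; _-_; _<_; _≤_; ↥_; ↧_; ↧ₙ_; toℚᵘ)
import Data.Rational.Properties as ℚ
import Data.Rational.Solver as ℚ
open import Data.Rational.Unnormalised.Base as ℚᵘ using (ℚᵘ; mkℚᵘ; *≡*; *≤*; *<*)
import Data.Rational.Unnormalised.Properties as ℚᵘ
open import Data.Sum.Base using (_⊎_; inj₁; inj₂)
open import Data.Vec.Base using (Vec; []; _∷_; lookup; reverse)
open import Function.Base using (_∘_)
open import Level using (0ℓ)
open import Relation.Binary.PropositionalEquality hiding (J)
open import Relation.Nullary using (¬_; Dec; yes; no; contradiction)
open import Relation.Nullary.Decidable using (_×-dec_; True; toWitness; toWitnessFalse)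
import Data.Sum.Base as Sum
open import Relation.Unary using (Pred; Decidable)

open import Algebra.Properties.Monoid.Mult ℚ.+-0-monoid using () renaming (_×_ to _·_)
open import Algebra.Properties.CommutativeSemiring.Exp
  (CommutativeRing.commutativeSemiring ℚ.+-*-commutativeRing)
  using (_^_; ^-assocʳ; ^-distrib-*)

𝔽₂ : Set
𝔽₂ = Bool

module _ where

  open CommutativeRing xor-∧-commutativeRing using (+-commutativeMonoid; 0#; 1#)
    renaming (_*_ to _*₂_)
  open import Algebra.Properties.CommutativeMonoid.Sum +-commutativeMonoid
    using (sum⁺-syntax)

  -- The position n + ℓ, for 0 ≤ n ≤ N - L - 1 and 0 ≤ ℓ ≤ L.

  shift : ∀ {N L} → Fin (N ℕ.∸ L) → Fin (suc L) → Fin N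
  shift {N} {L} n ℓ = fromℕ< {toℕ n ℕ.+ toℕ ℓ} (begin-strict
    toℕ n ℕ.+ toℕ ℓ  ≤⟨ ℕ.+-monoʳ-≤ (toℕ n) (toℕ≤pred[n] ℓ) ⟩
    toℕ n ℕ.+ L      <⟨ ℕ.+-monoˡ-< L (toℕ<n n) ⟩
    N ℕ.∸ L ℕ.+ L    ≡⟨ ℕ.m∸n+n≡m (ℕ.<⇒≤ (ℕ.m∸n≢0⇒n<m {N} {L} (nonempty n))) ⟩
    N                ∎)
    where
    open ℕ.≤-Reasoning
    nonempty : ∀ {k} → Fin k → k ≢ 0
    nonempty () refl

  Annihilates : ∀ {N L} → Vec 𝔽₂ (suc L) → Vec 𝔽₂ N → Set
  Annihilates {N} {L} c s =
    ∀ (n : Fin (N ℕ.∸ L)) → ∑[ ℓ ≤ L ] (lookup c ℓ *₂ lookup s (shift n ℓ)) ≡ 0#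

  HasRecurrence : ∀ {N} → Vec 𝔽₂ N → ℕ → Set
  HasRecurrence s L = ∃[ c ] (lookup {n = suc L} c (fromℕ L) ≡ 1# × Annihilates c s)

  hasRecurrence? : ∀ {N} (s : Vec 𝔽₂ N) → Decidable (HasRecurrence s)
  hasRecurrence? s L = anySubset? λ c →
    lookup c (fromℕ L) Bool.≟ 1# ×-dec all? λ n → _ Bool.≟ 0#

  hasRecurrence-N : ∀ {N} (s : Vec 𝔽₂ N) → HasRecurrence s N
  hasRecurrence-N {N} s = ones (suc N) , lookup-ones (fromℕ N) , vacuous
    where
    ones : ∀ n → Vec 𝔽₂ n
    ones zero    = []
    ones (suc n) = 1# ∷ ones n
    lookup-ones : ∀ {n} (i : Fin n) → lookup (ones n) i ≡ 1#
    lookup-ones Fin.zero    = refl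
    lookup-ones (Fin.suc i) = lookup-ones i
    vacuous : Annihilates (ones (suc N)) s
    vacuous n with () ← subst Fin (ℕ.n∸n≡0 N) n

IsLeast : Pred ℕ 0ℓ → Pred ℕ 0ℓ
IsLeast P m = P m × ∀ k → P k → m ℕ.≤ k

least : ∀ {P : Pred ℕ 0ℓ} → Decidable P → ∀ {n} → P n → ∃ (IsLeast P)
least P? {zero}  p = 0 , p , λ _ _ → z≤n
least P? {suc n} p with P? 0
... | yes p₀ = 0 , p₀ , λ _ _ → z≤n
... | no ¬p₀ =
  let m , pm , min = least (P? ∘ suc) {n} p
  in suc m , pm , λ { zero p₀ → contradiction p₀ ¬p₀ ; (suc k) pk → s≤s (min k pk) }

linearComplexity-least : ∀ {N} (s : Vec 𝔽₂ N) → ∃ (IsLeast (HasRecurrence s))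
linearComplexity-least s = least (hasRecurrence? s) (hasRecurrence-N s)

L : ∀ {N} → Vec 𝔽₂ N → ℕ
L s = proj₁ (linearComplexity-least s)

Lˢʸᵐ : ∀ {N} → Vec 𝔽₂ N → ℕ
Lˢʸᵐ s = L s ℕ.⊓ L (reverse s)

∑𝔽₂^ : ∀ N → (Vec 𝔽₂ N → ℕ) → ℕ
∑𝔽₂^ zero    f = f []
∑𝔽₂^ (suc N) f = ∑𝔽₂^ N (f ∘ (false ∷_)) ℕ.+ ∑𝔽₂^ N (f ∘ (true ∷_))

𝔼 : ∀ N → (Vec 𝔽₂ N → ℕ) → ℚ
𝔼 N f = (+ ∑𝔽₂^ N f / 2 ℕ.^ N) {{ℕ.m^n≢0 2 N}}

Eˡⁱⁿ⁻ˢʸᵐ : ℕ → ℚ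
Eˡⁱⁿ⁻ˢʸᵐ N = 𝔼 N Lˢʸᵐ

Eˡⁱⁿ⁻ᵉˣᵖ⁻ˢʸᵐ : ℕ → ℚ
Eˡⁱⁿ⁻ᵉˣᵖ⁻ˢʸᵐ N = 𝔼 N λ s → 2 ℕ.^ Lˢʸᵐ s

-- Two-sided Dedekind cuts; locatedness makes either half determine the other.

record ℝ : Set₁ where
  field
    lower upper : ℚ → Set
    inhabitedˡ  : ∃ lower
    inhabitedᵘ  : ∃ upper
    closedˡ     : ∀ {p q} → p < q → lower q → lower p
    closedᵘ     : ∀ {p q} → p < q → upper p → upper q
    roundedˡ    : ∀ {p} → lower p → ∃[ q ] (p < q × lower q)
    roundedᵘ    : ∀ {q} → upper q → ∃[ p ] (p < q × upper p)
    disjoint    : ∀ {q} → lower q → upper q → ⊥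
    located     : ∀ {p q} → p < q → lower p ⊎ upper q

open ℝ

infix 4 _≤ᴿ_
_≤ᴿ_ : ℝ → ℝ → Set
x ≤ᴿ y = ∀ q → lower x q → lower y q

lower<upper : ∀ (x : ℝ) {p q} → lower x p → upper x q → p < q
lower<upper x {p} {q} l u with p ℚ.<? q
... | yes p<q = p<q
... | no  p≮q with q ℚ.≟ p
...   | yes refl = contradiction u (disjoint x l)
...   | no  q≢p  = contradiction u (disjoint x (closedˡ x q<p l))
  where q<p = ℚ.≰⇒> λ p≤q → q≢p (ℚ.≤-antisym (ℚ.≮⇒≥ p≮q) p≤q)

fromℚ : ℚ → ℝ
fromℚ r = record
  { lower      = _< r
  ; upper      = r <_
  ; inhabitedˡ = r - 1ℚ , subst (r - 1ℚ <_) (ℚ.+-identityʳ r) (ℚ.+-monoʳ-< r {x = - 1ℚ} {y = 0ℚ} (from-<? _))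
  ; inhabitedᵘ = r + 1ℚ , subst (_< r + 1ℚ) (ℚ.+-identityʳ r) (ℚ.+-monoʳ-< r {x = 0ℚ} {y = 1ℚ} (from-<? _))
  ; closedˡ    = ℚ.<-trans
  ; closedᵘ    = λ p<q r<p → ℚ.<-trans r<p p<q
  ; roundedˡ   = λ p<r → let q , p<q , q<r = ℚ.<-dense p<r in q , p<q , q<r
  ; roundedᵘ   = λ r<q → let p , r<p , p<q = ℚ.<-dense r<q in p , p<q , r<p
  ; disjoint   = ℚ.<-asym
  ; located    = loc
  }
  where
  from-<? : ∀ {p q} → True (p ℚ.<? q) → p < q
  from-<? = toWitness
  loc : ∀ {p q} → p < q → p < r ⊎ r < q
  loc {p} {q} p<q with p ℚ.<? r
  ... | yes p<r = inj₁ p<r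
  ... | no  p≮r = inj₂ (ℚ.≤-<-trans (ℚ.≮⇒≥ p≮r) p<q)

infix 8 -ᴿ_
-ᴿ_ : ℝ → ℝ
-ᴿ x = record
  { lower      = λ q → upper x (- q)
  ; upper      = λ q → lower x (- q)
  ; inhabitedˡ = let q , u = inhabitedᵘ x in - q , subst (upper x) (sym (neg-inv q)) u
  ; inhabitedᵘ = let q , l = inhabitedˡ x in - q , subst (lower x) (sym (neg-inv q)) l
  ; closedˡ    = λ p<q → closedᵘ x (ℚ.neg-antimono-< p<q)
  ; closedᵘ    = λ p<q → closedˡ x (ℚ.neg-antimono-< p<q)
  ; roundedˡ   = λ {p} u → let q , q<-p , uq = roundedᵘ x u in
      - q , subst (_< - q) (neg-inv p) (ℚ.neg-antimono-< q<-p) ,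
      subst (upper x) (sym (neg-inv q)) uq
  ; roundedᵘ   = λ {p} l → let q , -p<q , lq = roundedˡ x l in
      - q , subst (- q <_) (neg-inv p) (ℚ.neg-antimono-< -p<q) ,
      subst (lower x) (sym (neg-inv q)) lq
  ; disjoint   = λ u l → disjoint x l u
  ; located    = λ p<q → Sum.swap (located x (ℚ.neg-antimono-< p<q))
  }
  where
  open import Algebra.Properties.Group ℚ.+-0-group using () renaming (⁻¹-involutive to neg-inv)

·-toℚᵘ : ∀ n {p u} → toℚᵘ p ℚᵘ.≃ u →
         toℚᵘ (n · p) ℚᵘ.≃ mkℚᵘ (+ n ℤ.* ℚᵘ.↥ u) (ℚᵘ.denominator-1 u)
·-toℚᵘ zero    {p} {u} p≃u = *≡* refl
·-toℚᵘ (suc n) {p} {u@(mkℚᵘ a d)} p≃u = begin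
  toℚᵘ (p + n · p)            ≈⟨ ℚ.toℚᵘ-homo-+ p (n · p) ⟩
  toℚᵘ p ℚᵘ.+ toℚᵘ (n · p)    ≈⟨ ℚᵘ.+-cong p≃u (·-toℚᵘ n p≃u) ⟩
  u ℚᵘ.+ mkℚᵘ (+ n ℤ.* a) d   ≈⟨ *≡* (collect (+ n) a (+ suc d)) ⟩
  mkℚᵘ (+ suc n ℤ.* a) d      ∎
  where
  open ℚᵘ.≃-Reasoning
  collect : ∀ n a d → (a ℤ.* d ℤ.+ n ℤ.* a ℤ.* d) ℤ.* d ≡ (+ 1 ℤ.+ n) ℤ.* a ℤ.* (d ℤ.* d)
  collect = solve 3 (λ n a d → (a :* d :+ n :* a :* d) :* d := (con (+ 1) :+ n) :* a :* (d :* d)) refl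
    where open ℤ.+-*-Solver

·-recip : ∀ n d {m} → suc m ≡ suc d ℕ.* n → n · (+ 1 / suc m) ≡ + 1 / suc d
·-recip n d {m} m≡dn = ℚ.toℚᵘ-injective (begin
  toℚᵘ (n · (+ 1 / suc m))  ≈⟨ ·-toℚᵘ n (ℚ.toℚᵘ-fromℚᵘ (mkℚᵘ (+ 1) m)) ⟩
  mkℚᵘ (+ n ℤ.* + 1) m      ≈⟨ *≡* cross ⟩
  mkℚᵘ (+ 1) d              ≈⟨ ℚ.toℚᵘ-fromℚᵘ (mkℚᵘ (+ 1) d) ⟨
  toℚᵘ (+ 1 / suc d)        ∎)
  where
  open ℚᵘ.≃-Reasoning
  cross : + n ℤ.* + 1 ℤ.* + suc d ≡ + 1 ℤ.* + suc m
  cross = trans (cong (ℤ._* + suc d) (ℤ.*-identityʳ (+ n)))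
         (trans (sym (ℤ.pos-* n (suc d)))
         (trans (cong +_ (trans (ℕ.*-comm n (suc d)) (sym m≡dn)))
                (sym (ℤ.*-identityˡ (+ suc m)))))

·-mono-≤ : ∀ n {p q} → p ≤ q → n · p ≤ n · q
·-mono-≤ zero    p≤q = ℚ.≤-refl
·-mono-≤ (suc n) p≤q = ℚ.+-mono-≤ p≤q (·-mono-≤ n p≤q)

archimedean : ∀ q {ε} → 0ℚ < ε → ∃[ n ] q < n · ε
archimedean q@(mkℚ a d-1 _) {ε@(mkℚ (ℤ.+[1+ e ]) f-1 _)} _ =
  n , ℚ.toℚᵘ-cancel-< (ℚᵘ.<-respʳ-≃ (ℚᵘ.≃-sym (·-toℚᵘ n {ε} ℚᵘ.≃-refl)) (*<* bound))
  where
  k n : ℕ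
  k = ℤ.∣ a ∣ ℕ.* suc f-1
  n = suc k
  bound : a ℤ.* + suc f-1 ℤ.< + n ℤ.* ℤ.+[1+ e ] ℤ.* + suc d-1
  bound = begin-strict
    a ℤ.* + suc f-1            ≤⟨ ℤ.*-monoʳ-≤-nonNeg (+ suc f-1) (i≤∣i∣ a) ⟩
    + ℤ.∣ a ∣ ℤ.* + suc f-1    ≡⟨ sym (ℤ.pos-* ℤ.∣ a ∣ (suc f-1)) ⟩
    + k                        <⟨ ℤ.+<+ (ℕ.n<1+n k) ⟩
    + n                        ≤⟨ ℤ.+≤+ (ℕ.≤-trans (ℕ.m≤m*n n (suc e)) (ℕ.m≤m*n (n ℕ.* suc e) (suc d-1))) ⟩
    + (n ℕ.* suc e ℕ.* suc d-1) ≡⟨ ℤ.pos-* (n ℕ.* suc e) (suc d-1) ⟩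
    + (n ℕ.* suc e) ℤ.* + suc d-1 ≡⟨ cong (ℤ._* + suc d-1) (ℤ.pos-* n (suc e)) ⟩
    + n ℤ.* ℤ.+[1+ e ] ℤ.* + suc d-1  ∎
    where
    open ℤ.≤-Reasoning
    i≤∣i∣ : ∀ i → i ℤ.≤ + ℤ.∣ i ∣
    i≤∣i∣ (+ n)     = ℤ.≤-refl
    i≤∣i∣ -[1+ n ] = ℤ.-≤+
archimedean q {mkℚ (+ 0) _ _}    (ℚ.*<* (ℤ.+<+ ()))
archimedean q {mkℚ -[1+ _ ] _ _} (ℚ.*<* ())

recip-small : ∀ {δ} → 0ℚ < δ → ∃[ k ] + 1 / suc k < δ
recip-small {δ} 0<δ with archimedean 1ℚ 0<δ
... | zero  , 1<0  = contradiction 1<0 (toWitnessFalse {a? = 1ℚ ℚ.<? 0ℚ} _)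
... | suc k , 1<kδ = k , ℚ.≰⇒> λ δ≤1/k → ℚ.<-irrefl refl (begin-strict
  1ℚ                     <⟨ 1<kδ ⟩
  suc k · δ              ≤⟨ ·-mono-≤ (suc k) δ≤1/k ⟩
  suc k · (+ 1 / suc k)  ≡⟨ ·-recip (suc k) 0 (sym (ℕ.*-identityˡ (suc k))) ⟩
  1ℚ                     ∎)
  where open ℚ.≤-Reasoning

recip-pos : ∀ k → 0ℚ < + 1 / suc k
recip-pos k = ℚ.positive⁻¹ (+ 1 / suc k) {{ℚ.normalize-pos 1 (suc k)}}

p<q⇒0<q-p : ∀ {p q} → p < q → 0ℚ < q - p
p<q⇒0<q-p {p} {q} p<q = subst (_< q - p) (ℚ.+-inverseʳ p) (ℚ.+-monoˡ-< (- p) p<q)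

p<p+ε : ∀ p {ε} → 0ℚ < ε → p < p + ε
p<p+ε p {ε} 0<ε = subst (_< p + ε) (ℚ.+-identityʳ p) (ℚ.+-monoʳ-< p 0<ε)

halve : ∀ {δ} → 0ℚ < δ → ∃[ ε ] (0ℚ < ε × ε + ε < δ)
halve {δ} 0<δ =
  let h , 0<h , h<δ = ℚ.<-dense 0<δ in
  ½ * h , subst (_< ½ * h) (ℚ.*-zeroʳ ½) (ℚ.*-monoʳ-<-pos ½ 0<h) ,
  subst (_< δ) (sym (trans (sym (ℚ.*-distribʳ-+ h ½ ½)) (ℚ.*-identityˡ h))) h<δ

approx : ∀ (x : ℝ) {δ} → 0ℚ < δ → ∃₂ λ a b → lower x a × upper x b × b < a + δ
approx x {δ} 0<δ =
  let ε , 0<ε , ε+ε<δ = halve 0<δ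
      l , lx          = inhabitedˡ x
      u , ux          = inhabitedᵘ x
      n , u-l<nε      = archimedean (u - l) 0<ε
  in search 0<ε ε+ε<δ ux n lx (subst (_< l + n · ε) (rearrange l u) (ℚ.+-monoʳ-< l u-l<nε))
  where
  rearrange : ∀ l u → l + (u - l) ≡ u
  rearrange = solve 2 (λ l u → l :+ (u :- l) := u) refl
    where open ℚ.+-*-Solver
  search : ∀ {ε u} → 0ℚ < ε → ε + ε < δ → upper x u →
           ∀ n {l} → lower x l → u < l + n · ε →
           ∃₂ λ a b → lower x a × upper x b × b < a + δ
  search 0<ε ε+ε<δ ux zero {l} lx u<l = contradiction
    (lower<upper x lx ux) (ℚ.<-asym (subst (_ <_) (ℚ.+-identityʳ l) u<l))
  search {ε} {u} 0<ε ε+ε<δ ux (suc n) {l} lx u<l+nε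
    with located x {l + ε} {l + ε + ε} (p<p+ε (l + ε) 0<ε)
  ... | inj₁ l′x = search 0<ε ε+ε<δ ux n l′x
                     (subst (u <_) (sym (ℚ.+-assoc l ε (n · ε))) u<l+nε)
  ... | inj₂ u′x = l , l + ε + ε , lx , u′x ,
                     subst (_< l + δ) (sym (ℚ.+-assoc l ε ε)) (ℚ.+-monoʳ-< l ε+ε<δ)

-- By roundedness, q < a + b here gives the same cut as q ≡ a + b.

infixl 6 _+ᴿ_ _-ᴿ_
_+ᴿ_ : ℝ → ℝ → ℝ
x +ᴿ y = record
  { lower      = λ q → ∃₂ λ a b → lower x a × lower y b × q < a + b
  ; upper      = λ q → ∃₂ λ a b → upper x a × upper y b × a + b < q
  ; inhabitedˡ = let a , ax = inhabitedˡ x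
                     b , by = inhabitedˡ y
                     q , q<a+b = proj₁ (unbounded (a + b))
                 in q , a , b , ax , by , q<a+b
  ; inhabitedᵘ = let a , ax = inhabitedᵘ x
                     b , by = inhabitedᵘ y
                     q , a+b<q = proj₂ (unbounded (a + b))
                 in q , a , b , ax , by , a+b<q
  ; closedˡ    = λ { p<q (a , b , ax , by , q<a+b) → a , b , ax , by , ℚ.<-trans p<q q<a+b }
  ; closedᵘ    = λ { p<q (a , b , ax , by , a+b<p) → a , b , ax , by , ℚ.<-trans a+b<p p<q }
  ; roundedˡ   = λ { (a , b , ax , by , p<a+b) →
      let q , p<q , q<a+b = ℚ.<-dense p<a+b in q , p<q , a , b , ax , by , q<a+b }
  ; roundedᵘ   = λ { (a , b , ax , by , a+b<q) →
      let p , a+b<p , p<q = ℚ.<-dense a+b<q in p , p<q , a , b , ax , by , a+b<p }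
  ; disjoint   = λ { (a , b , ax , by , q<a+b) (a′ , b′ , a′x , b′y , a′+b′<q) →
      ℚ.<-asym (ℚ.+-mono-< (lower<upper x ax a′x) (lower<upper y by b′y))
               (ℚ.<-trans a′+b′<q q<a+b) }
  ; located    = loc
  }
  where
  unbounded : ∀ p → (∃[ q ] q < p) × (∃[ q ] p < q)
  unbounded p = inhabitedˡ (fromℚ p) , inhabitedᵘ (fromℚ p)

  interchange : ∀ a b ε → a + ε + (b + ε) ≡ a + b + (ε + ε)
  interchange = solve 3 (λ a b ε → a :+ ε :+ (b :+ ε) := a :+ b :+ (ε :+ ε)) refl
    where open ℚ.+-*-Solver

  cancel : ∀ p q → p + (q - p) ≡ q
  cancel = solve 2 (λ p q → p :+ (q :- p) := q) refl
    where open ℚ.+-*-Solver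

  decide : ∀ p q ε a a′ b b′ → ε + ε < q - p →
           lower x a → upper x a′ → a′ < a + ε →
           lower y b → upper y b′ → b′ < b + ε →
           (∃₂ λ a b → lower x a × lower y b × p < a + b) ⊎
           (∃₂ λ a b → upper x a × upper y b × a + b < q)
  decide p q ε a a′ b b′ ε+ε<q-p ax a′x a′<a+ε by b′y b′<b+ε with p ℚ.<? a + b
  ... | yes p<a+b = inj₁ (a , b , ax , by , p<a+b)
  ... | no  p≮a+b = inj₂ (a′ , b′ , a′x , b′y , (begin-strict
    a′ + b′            <⟨ ℚ.+-mono-< a′<a+ε b′<b+ε ⟩
    a + ε + (b + ε)    ≡⟨ interchange a b ε ⟩
    a + b + (ε + ε)    ≤⟨ ℚ.+-monoˡ-≤ (ε + ε) (ℚ.≮⇒≥ p≮a+b) ⟩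
    p + (ε + ε)        <⟨ ℚ.+-monoʳ-< p ε+ε<q-p ⟩
    p + (q - p)        ≡⟨ cancel p q ⟩
    q                  ∎))
    where open ℚ.≤-Reasoning

  loc : ∀ {p q} → p < q →
        (∃₂ λ a b → lower x a × lower y b × p < a + b) ⊎
        (∃₂ λ a b → upper x a × upper y b × a + b < q)
  loc {p} {q} p<q =
    let ε , 0<ε , ε+ε<q-p         = halve (p<q⇒0<q-p p<q)
        a , a′ , ax , a′x , a′<a+ε = approx x 0<ε
        b , b′ , by , b′y , b′<b+ε = approx y 0<ε
    in decide p q ε a a′ b b′ ε+ε<q-p ax a′x a′<a+ε by b′y b′<b+ε

_-ᴿ_ : ℝ → ℝ → ℝ
x -ᴿ y = x +ᴿ (-ᴿ y)

2ℚ : ℚ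
2ℚ = + 2 / 1

2^ℤ : ℤ → ℚ
2^ℤ (+ n)    = 2ℚ ^ n
2^ℤ -[1+ n ] = ½ ^ suc n

-- For t = a/b in lowest terms: p ≤ 2ᵗ iff pᵇ ≤ 2ᵃ, for p > 0.

infix 4 _≤2^_ 2^_≤_
_≤2^_ : ℚ → ℚ → Set
p ≤2^ t = 0ℚ < p × p ^ ↧ₙ t ≤ 2^ℤ (↥ t)

2^_≤_ : ℚ → ℚ → Set
2^ t ≤ p = 0ℚ < p × 2^ℤ (↥ t) ≤ p ^ ↧ₙ t

*-mono-≤ : ∀ {p q r s} → 0ℚ ≤ p → p ≤ q → 0ℚ ≤ r → r ≤ s → p * r ≤ q * s
*-mono-≤ {p} {q} {r} {s} 0≤p p≤q 0≤r r≤s = ℚ.≤-trans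
  (ℚ.*-monoʳ-≤-nonNeg r {{ℚ.nonNegative 0≤r}} p≤q)
  (ℚ.*-monoˡ-≤-nonNeg q {{ℚ.nonNegative (ℚ.≤-trans 0≤p p≤q)}} r≤s)

*-pos : ∀ {p q} → 0ℚ < p → 0ℚ < q → 0ℚ < p * q
*-pos {p} {q} 0<p 0<q =
  subst (_< p * q) (ℚ.*-zeroʳ p) (ℚ.*-monoʳ-<-pos p {{ℚ.positive 0<p}} 0<q)

0<1 : 0ℚ < 1ℚ
0<1 = toWitness {a? = 0ℚ ℚ.<? 1ℚ} _

^-pos : ∀ {p} → 0ℚ < p → ∀ n → 0ℚ < p ^ n
^-pos 0<p zero    = 0<1
^-pos 0<p (suc n) = *-pos 0<p (^-pos 0<p n)

^-mono-≤ : ∀ {p q} → 0ℚ < p → p ≤ q → ∀ n → p ^ n ≤ q ^ n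
^-mono-≤ 0<p p≤q zero    = ℚ.≤-refl
^-mono-≤ 0<p p≤q (suc n) =
  *-mono-≤ (ℚ.<⇒≤ 0<p) p≤q (ℚ.<⇒≤ (^-pos 0<p n)) (^-mono-≤ 0<p p≤q n)

^-mono-< : ∀ {p q} → 0ℚ < p → p < q → ∀ n → p ^ suc n < q ^ suc n
^-mono-< {p} {q} 0<p p<q n = ℚ.≤-<-trans
  (ℚ.*-monoˡ-≤-nonNeg p {{ℚ.nonNegative (ℚ.<⇒≤ 0<p)}} (^-mono-≤ 0<p (ℚ.<⇒≤ p<q) n))
  (ℚ.*-monoˡ-<-pos (q ^ n) {{ℚ.positive (^-pos (ℚ.<-trans 0<p p<q) n)}} p<q)

^-cancel-≤ : ∀ {p q} → 0ℚ < q → ∀ n .{{_ : NonZero n}} → p ^ n ≤ q ^ n → p ≤ q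
^-cancel-≤ 0<q (suc n) pⁿ≤qⁿ = ℚ.≮⇒≥ λ q<p →
  ℚ.<-irrefl refl (ℚ.<-≤-trans (^-mono-< 0<q q<p n) pⁿ≤qⁿ)

^-swap : ∀ p m n → (p ^ m) ^ n ≡ (p ^ n) ^ m
^-swap p m n = trans (^-assocʳ p m n)
              (trans (cong (p ^_) (ℕ.*-comm m n)) (sym (^-assocʳ p n m)))

1^n≡1 : ∀ n → 1ℚ ^ n ≡ 1ℚ
1^n≡1 zero    = refl
1^n≡1 (suc n) = trans (ℚ.*-identityˡ (1ℚ ^ n)) (1^n≡1 n)

0<2 : 0ℚ < 2ℚ
0<2 = toWitness {a? = 0ℚ ℚ.<? 2ℚ} _

0<½ : 0ℚ < ½
0<½ = toWitness {a? = 0ℚ ℚ.<? ½} _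

1≤2^n : ∀ n → 1ℚ ≤ 2ℚ ^ n
1≤2^n n = subst (_≤ 2ℚ ^ n) (1^n≡1 n) (^-mono-≤ 0<1 (toWitness {a? = 1ℚ ℚ.≤? 2ℚ} _) n)

½^n≤1 : ∀ n → ½ ^ n ≤ 1ℚ
½^n≤1 n = subst (½ ^ n ≤_) (1^n≡1 n) (^-mono-≤ 0<½ (toWitness {a? = ½ ℚ.≤? 1ℚ} _) n)

2^ℤ-pos : ∀ i → 0ℚ < 2^ℤ i
2^ℤ-pos (+ n)    = ^-pos 0<2 n
2^ℤ-pos -[1+ n ] = ^-pos 0<½ (suc n)

2^ℤ-suc : ∀ i → 2^ℤ (ℤ.suc i) ≡ 2ℚ * 2^ℤ i
2^ℤ-suc (+ n)        = refl
2^ℤ-suc -[1+ zero ]  = refl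
2^ℤ-suc -[1+ suc n ] = sym (trans (sym (ℚ.*-assoc 2ℚ ½ (½ ^ suc n))) (ℚ.*-identityˡ (½ ^ suc n)))

2^ℤ-+ : ∀ i n → 2^ℤ (+ n ℤ.+ i) ≡ 2ℚ ^ n * 2^ℤ i
2^ℤ-+ i zero    = trans (cong 2^ℤ (ℤ.+-identityˡ i)) (sym (ℚ.*-identityˡ (2^ℤ i)))
2^ℤ-+ i (suc n) = begin
  2^ℤ (+ suc n ℤ.+ i)        ≡⟨ cong 2^ℤ (ℤ.+-assoc (+ 1) (+ n) i) ⟩
  2^ℤ (ℤ.suc (+ n ℤ.+ i))    ≡⟨ 2^ℤ-suc (+ n ℤ.+ i) ⟩
  2ℚ * 2^ℤ (+ n ℤ.+ i)       ≡⟨ cong (2ℚ *_) (2^ℤ-+ i n) ⟩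
  2ℚ * (2ℚ ^ n * 2^ℤ i)      ≡⟨ ℚ.*-assoc 2ℚ (2ℚ ^ n) (2^ℤ i) ⟨
  2ℚ ^ suc n * 2^ℤ i         ∎
  where open ≡-Reasoning

2^ℤ-* : ∀ i n → 2^ℤ (i ℤ.* + n) ≡ 2^ℤ i ^ n
2^ℤ-* (+ m)    n = trans (cong 2^ℤ (sym (ℤ.pos-* m n))) (sym (^-assocʳ 2ℚ m n))
2^ℤ-* -[1+ m ] n = begin
  2^ℤ (-[1+ m ] ℤ.* + n)        ≡⟨ cong 2^ℤ (ℤ.neg-distribˡ-* (+ suc m) (+ n)) ⟨
  2^ℤ (ℤ.- (+ suc m ℤ.* + n))   ≡⟨ cong (λ k → 2^ℤ (ℤ.- k)) (ℤ.pos-* (suc m) n) ⟨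
  2^ℤ (ℤ.- + (suc m ℕ.* n))     ≡⟨ 2^ℤ-neg (suc m ℕ.* n) ⟩
  ½ ^ (suc m ℕ.* n)             ≡⟨ ^-assocʳ ½ (suc m) n ⟨
  2^ℤ -[1+ m ] ^ n              ∎
  where
  open ≡-Reasoning
  2^ℤ-neg : ∀ k → 2^ℤ (ℤ.- + k) ≡ ½ ^ k
  2^ℤ-neg zero    = refl
  2^ℤ-neg (suc k) = refl

2^ℤ-mono : ∀ i j n → j ℤ.≤ + n ℤ.+ i → 2^ℤ j ≤ 2ℚ ^ n * 2^ℤ i
2^ℤ-mono i j n j≤n+i with ℤ.∣ + n ℤ.+ i ℤ.- j ∣ in eq
... | k = begin
  2^ℤ j                        ≡⟨ ℚ.*-identityˡ (2^ℤ j) ⟨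
  1ℚ * 2^ℤ j                   ≤⟨ ℚ.*-monoʳ-≤-nonNeg (2^ℤ j) {{ℚ.nonNegative (ℚ.<⇒≤ (2^ℤ-pos j))}} (1≤2^n k) ⟩
  2ℚ ^ k * 2^ℤ j               ≡⟨ 2^ℤ-+ j k ⟨
  2^ℤ (+ k ℤ.+ j)              ≡⟨ cong 2^ℤ k+j≡n+i ⟩
  2^ℤ (+ n ℤ.+ i)              ≡⟨ 2^ℤ-+ i n ⟩
  2ℚ ^ n * 2^ℤ i               ∎
  where
  open ℚ.≤-Reasoning
  k+j≡n+i : + k ℤ.+ j ≡ + n ℤ.+ i
  k+j≡n+i = trans
    (cong (ℤ._+ j) (trans (cong +_ (sym eq)) (ℤ.0≤i⇒+∣i∣≡i (ℤ.i≤j⇒0≤j-i j≤n+i))))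
    (solve 2 (λ x j → x :- j :+ j := x) refl (+ n ℤ.+ i) j)
    where open ℤ.+-*-Solver

small : ∀ t → ∃ (_≤2^ t)
small t = ½ ^ ℤ.∣ ↥ t ∣ , ^-pos 0<½ ℤ.∣ ↥ t ∣ , go (↥ t) (ℚ.denominator-1 t)
  where
  go : ∀ i d → (½ ^ ℤ.∣ i ∣) ^ suc d ≤ 2^ℤ i
  go i d = ℚ.≤-trans
    (*-mono-≤ (ℚ.<⇒≤ (^-pos 0<½ ℤ.∣ i ∣)) ℚ.≤-refl (ℚ.<⇒≤ (^-pos (^-pos 0<½ ℤ.∣ i ∣) d))
      (subst ((½ ^ ℤ.∣ i ∣) ^ d ≤_) (1^n≡1 d) (^-mono-≤ (^-pos 0<½ ℤ.∣ i ∣) (½^n≤1 ℤ.∣ i ∣) d)))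
    (subst (_≤ 2^ℤ i) (sym (ℚ.*-identityʳ _)) (½^∣i∣≤2^i i))
    where
    ½^∣i∣≤2^i : ∀ i → ½ ^ ℤ.∣ i ∣ ≤ 2^ℤ i
    ½^∣i∣≤2^i (+ n)    = ℚ.≤-trans (½^n≤1 n) (1≤2^n n)
    ½^∣i∣≤2^i -[1+ n ] = ℚ.≤-refl

large : ∀ t → ∃ (2^ t ≤_)
large t = 2ℚ ^ ℤ.∣ ↥ t ∣ , ^-pos 0<2 ℤ.∣ ↥ t ∣ , go (↥ t) (ℚ.denominator-1 t)
  where
  go : ∀ i d → 2^ℤ i ≤ (2ℚ ^ ℤ.∣ i ∣) ^ suc d
  go i d = ℚ.≤-trans
    (subst (2^ℤ i ≤_) (sym (ℚ.*-identityʳ _)) (2^i≤2^∣i∣ i))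
    (*-mono-≤ (ℚ.<⇒≤ (^-pos 0<2 ℤ.∣ i ∣)) ℚ.≤-refl (ℚ.<⇒≤ 0<1)
      (subst (_≤ (2ℚ ^ ℤ.∣ i ∣) ^ d) (1^n≡1 d) (^-mono-≤ 0<1 (1≤2^n ℤ.∣ i ∣) d)))
    where
    2^i≤2^∣i∣ : ∀ i → 2^ℤ i ≤ 2ℚ ^ ℤ.∣ i ∣
    2^i≤2^∣i∣ (+ n)    = ℚ.≤-refl
    2^i≤2^∣i∣ -[1+ n ] = ℚ.≤-trans (½^n≤1 (suc n)) (1≤2^n (suc n))

2^-separate : ∀ {p q s t} → p ≤2^ s → s < t → 2^ t ≤ q → p ≤ q
2^-separate {p} {q} {s@(mkℚ i b-1 _)} {t@(mkℚ j d-1 _)} (0<p , pᵇ≤2ⁱ) (ℚ.*<* id<jb) (0<q , 2ʲ≤qᵈ) =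
  ^-cancel-≤ 0<q (b ℕ.* d) (begin
    p ^ (b ℕ.* d)    ≡⟨ ^-assocʳ p b d ⟨
    (p ^ b) ^ d      ≤⟨ ^-mono-≤ (^-pos 0<p b) pᵇ≤2ⁱ d ⟩
    2^ℤ i ^ d        ≡⟨ 2^ℤ-* i d ⟨
    2^ℤ (i ℤ.* + d)  ≤⟨ 2^ℤ-mono (j ℤ.* + b) (i ℤ.* + d) 0 (ℤ.≤-trans (ℤ.<⇒≤ id<jb) (ℤ.≤-reflexive (sym (ℤ.+-identityˡ _)))) ⟩
    1ℚ * 2^ℤ (j ℤ.* + b)  ≡⟨ ℚ.*-identityˡ _ ⟩
    2^ℤ (j ℤ.* + b)  ≡⟨ 2^ℤ-* j b ⟩
    2^ℤ j ^ b        ≤⟨ ^-mono-≤ (2^ℤ-pos j) 2ʲ≤qᵈ b ⟩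
    (q ^ d) ^ b      ≡⟨ ^-swap q d b ⟩
    (q ^ b) ^ d      ≡⟨ ^-assocʳ q b d ⟩
    q ^ (b ℕ.* d)    ∎)
  where
  open ℚ.≤-Reasoning
  b d : ℕ
  b = suc b-1
  d = suc d-1

double : ∀ {p q} → 0ℚ < p → p < q → ∃[ n ] 2ℚ * p ^ suc n ≤ q ^ suc n
double {p} {q} 0<p p<q with archimedean p (p<q⇒0<q-p p<q)
... | zero  , p<0  = contradiction p<0 (ℚ.<-asym 0<p)
... | suc n , p<nδ = n , ℚ.*-cancelˡ-≤-pos p {{ℚ.positive 0<p}} (begin
  p * (2ℚ * p ^ suc n)                 ≡⟨ regroup p (p ^ suc n) ⟩
  p ^ suc n * (p + p)                  ≤⟨ ℚ.*-monoˡ-≤-nonNeg (p ^ suc n) {{ℚ.nonNegative (ℚ.<⇒≤ (^-pos 0<p (suc n)))}}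
                                            (ℚ.+-monoʳ-≤ p (ℚ.<⇒≤ p<nδ)) ⟩
  p ^ suc n * (p + suc n · δ)          ≤⟨ bernoulli (suc n) ⟩
  p * q ^ suc n                        ∎)
  where
  open ℚ.≤-Reasoning
  open ℚ.+-*-Solver
  δ : ℚ
  δ = q - p
  0≤δ : 0ℚ ≤ δ
  0≤δ = ℚ.<⇒≤ (p<q⇒0<q-p p<q)
  0≤nδ : ∀ n → 0ℚ ≤ n · δ
  0≤nδ zero    = ℚ.≤-refl
  0≤nδ (suc n) = ℚ.+-mono-≤ 0≤δ (0≤nδ n)
  regroup : ∀ p x → p * (2ℚ * x) ≡ x * (p + p)
  regroup = solve 2 (λ p x → p :* (con 2ℚ :* x) := x :* (p :+ p)) refl
  expand : ∀ p q x m → x * (p + m) * q ≡ p * x * (p + (q - p + m)) + x * (m * (q - p))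
  expand = solve 4 (λ p q x m →
    x :* (p :+ m) :* q := p :* x :* (p :+ (q :- p :+ m)) :+ x :* (m :* (q :- p))) refl
  bernoulli : ∀ n → p ^ n * (p + n · δ) ≤ p * q ^ n
  bernoulli zero    = ℚ.≤-reflexive (trans (ℚ.*-identityˡ _)
                        (trans (ℚ.+-identityʳ p) (sym (ℚ.*-identityʳ p))))
  bernoulli (suc n) = begin
    p ^ suc n * (p + suc n · δ)
      ≡⟨ ℚ.+-identityʳ _ ⟨
    p ^ suc n * (p + suc n · δ) + 0ℚ
      ≤⟨ ℚ.+-monoʳ-≤ (p ^ suc n * (p + suc n · δ))
           (*-nonNeg (ℚ.<⇒≤ (^-pos 0<p n)) (*-nonNeg (0≤nδ n) 0≤δ)) ⟩
    p ^ suc n * (p + suc n · δ) + p ^ n * (n · δ * δ)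
      ≡⟨ expand p q (p ^ n) (n · δ) ⟨
    p ^ n * (p + n · δ) * q
      ≤⟨ ℚ.*-monoʳ-≤-nonNeg q {{ℚ.nonNegative (ℚ.<⇒≤ (ℚ.<-trans 0<p p<q))}} (bernoulli n) ⟩
    p * q ^ n * q
      ≡⟨ trans (ℚ.*-assoc p (q ^ n) q) (cong (p *_) (ℚ.*-comm (q ^ n) q)) ⟩
    p * q ^ suc n ∎
    where
    *-nonNeg : ∀ {x y} → 0ℚ ≤ x → 0ℚ ≤ y → 0ℚ ≤ x * y
    *-nonNeg {x} {y} 0≤x 0≤y = *-mono-≤ {0ℚ} {x} {0ℚ} {y} ℚ.≤-refl 0≤x ℚ.≤-refl 0≤y

2^-close : ∀ {p q} n → 0ℚ < p → p < q → 2ℚ * p ^ suc n ≤ q ^ suc n →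
           ∀ s t → t < s + + 1 / suc n → ¬ p ≤2^ s → 2^ t ≤ q
2^-close {p} {q} n 0<p p<q 2pᵐ≤qᵐ s@(mkℚ i b-1 _) t@(mkℚ j d-1 _) t<s+1/m p≰2ˢ =
  0<q , ^-cancel-≤ (^-pos 0<q d) (b ℕ.* m) (begin
    2^ℤ j ^ (b ℕ.* m)                            ≡⟨ 2^ℤ-* j (b ℕ.* m) ⟨
    2^ℤ (j ℤ.* + (b ℕ.* m))                      ≤⟨ 2^ℤ-mono (i ℤ.* + (m ℕ.* d)) (j ℤ.* + (b ℕ.* m)) (b ℕ.* d) exponents ⟩
    2ℚ ^ (b ℕ.* d) * 2^ℤ (i ℤ.* + (m ℕ.* d))     ≡⟨ cong (2ℚ ^ (b ℕ.* d) *_) (2^ℤ-* i (m ℕ.* d)) ⟩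
    2ℚ ^ (b ℕ.* d) * 2^ℤ i ^ (m ℕ.* d)           ≤⟨ ℚ.*-monoˡ-≤-nonNeg (2ℚ ^ (b ℕ.* d)) {{ℚ.nonNegative (ℚ.<⇒≤ (^-pos 0<2 (b ℕ.* d)))}}
                                                      (^-mono-≤ (2^ℤ-pos i) 2ⁱ≤pᵇ (m ℕ.* d)) ⟩
    2ℚ ^ (b ℕ.* d) * (p ^ b) ^ (m ℕ.* d)         ≡⟨ cong (2ℚ ^ (b ℕ.* d) *_) (reassoc p b m d) ⟩
    2ℚ ^ (b ℕ.* d) * (p ^ m) ^ (b ℕ.* d)         ≡⟨ ^-distrib-* 2ℚ (p ^ m) (b ℕ.* d) ⟨
    (2ℚ * p ^ m) ^ (b ℕ.* d)                     ≤⟨ ^-mono-≤ (*-pos 0<2 (^-pos 0<p m)) 2pᵐ≤qᵐ (b ℕ.* d) ⟩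
    (q ^ m) ^ (b ℕ.* d)                          ≡⟨ reassoc′ q m b d ⟩
    (q ^ d) ^ (b ℕ.* m)                          ∎)
  where
  open ℚ.≤-Reasoning
  b d m : ℕ
  b = suc b-1
  d = suc d-1
  m = suc n
  0<q : 0ℚ < q
  0<q = ℚ.<-trans 0<p p<q
  2ⁱ≤pᵇ : 2^ℤ i ≤ p ^ b
  2ⁱ≤pᵇ = ℚ.<⇒≤ (ℚ.≰⇒> λ pᵇ≤2ⁱ → p≰2ˢ (0<p , pᵇ≤2ⁱ))
  reassoc : ∀ p b m d → (p ^ b) ^ (m ℕ.* d) ≡ (p ^ m) ^ (b ℕ.* d)
  reassoc p b m d = trans (^-assocʳ p b (m ℕ.* d))
    (trans (cong (p ^_) (solve 3 (λ b m d → b :* (m :* d) := m :* (b :* d)) refl b m d))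
           (sym (^-assocʳ p m (b ℕ.* d))))
    where open ℕ.+-*-Solver
  reassoc′ : ∀ q m b d → (q ^ m) ^ (b ℕ.* d) ≡ (q ^ d) ^ (b ℕ.* m)
  reassoc′ q m b d = trans (^-assocʳ q m (b ℕ.* d))
    (trans (cong (q ^_) (solve 3 (λ m b d → m :* (b :* d) := d :* (b :* m)) refl m b d))
           (sym (^-assocʳ q d (b ℕ.* m))))
    where open ℕ.+-*-Solver
  exponents : j ℤ.* + (b ℕ.* m) ℤ.≤ + (b ℕ.* d) ℤ.+ i ℤ.* + (m ℕ.* d)
  exponents with ℚᵘ.<-respʳ-≃ (ℚᵘ.≃-trans (ℚ.toℚᵘ-homo-+ s (+ 1 / m))
                   (ℚᵘ.+-cong (ℚᵘ.≃-refl {toℚᵘ s}) (ℚ.toℚᵘ-fromℚᵘ (mkℚᵘ (+ 1) n))))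
                 (ℚ.toℚᵘ-mono-< t<s+1/m)
  ... | *<* jbm<[im+b]d = ℤ.≤-trans (ℤ.<⇒≤ jbm<[im+b]d) (ℤ.≤-reflexive
    (trans (collect i (+ m) (+ b) (+ d))
      (cong₂ (λ x y → x ℤ.+ i ℤ.* y) (sym (ℤ.pos-* b d)) (sym (ℤ.pos-* m d)))))
    where
    collect : ∀ i m b d → (i ℤ.* m ℤ.+ + 1 ℤ.* b) ℤ.* d ≡ b ℤ.* d ℤ.+ i ℤ.* (m ℤ.* d)
    collect = solve 4 (λ i m b d →
      (i :* m :+ con (+ 1) :* b) :* d := b :* d :+ i :* (m :* d)) refl
      where open ℤ.+-*-Solver

-- 2ˣ is the cut with lower part ⋃ { p < 2ᵗ ∣ t < x } and upper part ⋃ { p > 2ᵗ ∣ t > x }.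

2^ᴿ : ℝ → ℝ
2^ᴿ x = record
  { lower      = λ q → ∃₂ λ t p → lower x t × p ≤2^ t × q < p
  ; upper      = λ q → ∃₂ λ t p → upper x t × 2^ t ≤ p × p < q
  ; inhabitedˡ = let t , tx  = inhabitedˡ x
                     p , p≤  = small t
                 in 0ℚ , t , p , tx , p≤ , proj₁ p≤
  ; inhabitedᵘ = let t , tx  = inhabitedᵘ x
                     p , ≤p  = large t
                 in p + 1ℚ , t , p , tx , ≤p , p<p+ε p 0<1
  ; closedˡ    = λ { q<q′ (t , p , tx , p≤ , q′<p) → t , p , tx , p≤ , ℚ.<-trans q<q′ q′<p }
  ; closedᵘ    = λ { q<q′ (t , p , tx , ≤p , p<q) → t , p , tx , ≤p , ℚ.<-trans p<q q<q′ }
  ; roundedˡ   = λ { (t , p , tx , p≤ , q<p) →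
      let q′ , q<q′ , q′<p = ℚ.<-dense q<p in q′ , q<q′ , t , p , tx , p≤ , q′<p }
  ; roundedᵘ   = λ { (t , p , tx , ≤p , p<q) →
      let q′ , p<q′ , q′<q = ℚ.<-dense p<q in q′ , q′<q , t , p , tx , ≤p , p<q′ }
  ; disjoint   = λ { (s , p , sx , p≤ , q<p) (t , p′ , tx , ≤p′ , p′<q) →
      ℚ.<-irrefl refl (ℚ.<-≤-trans (ℚ.<-trans p′<q q<p)
        (2^-separate p≤ (lower<upper x sx tx) ≤p′)) }
  ; located    = loc
  }
  where
  decide : ∀ {q r p₁ p₂} n s t → q < p₁ → p₁ < p₂ → p₂ < r →
           0ℚ < p₁ → 2ℚ * p₁ ^ suc n ≤ p₂ ^ suc n →
           lower x s → upper x t → t < s + + 1 / suc n →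
           Dec (p₁ ^ ↧ₙ s ≤ 2^ℤ (↥ s)) →
           (∃₂ λ t p → lower x t × p ≤2^ t × q < p) ⊎
           (∃₂ λ t p → upper x t × 2^ t ≤ p × p < r)
  decide {p₁ = p₁} n s t q<p₁ p₁<p₂ p₂<r 0<p₁ 2p₁ᵐ≤p₂ᵐ sx tx t<s+1/m (yes p₁≤2ˢ) =
    inj₁ (s , p₁ , sx , (0<p₁ , p₁≤2ˢ) , q<p₁)
  decide {p₂ = p₂} n s t q<p₁ p₁<p₂ p₂<r 0<p₁ 2p₁ᵐ≤p₂ᵐ sx tx t<s+1/m (no p₁≰2ˢ) =
    inj₂ (t , p₂ , tx , 2^-close n 0<p₁ p₁<p₂ 2p₁ᵐ≤p₂ᵐ s t t<s+1/m (p₁≰2ˢ ∘ proj₂) , p₂<r)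

  split : ∀ {q r p₁ p₂} → q < p₁ → p₁ < p₂ → p₂ < r → Dec (0ℚ < p₁) →
          (∃₂ λ t p → lower x t × p ≤2^ t × q < p) ⊎
          (∃₂ λ t p → upper x t × 2^ t ≤ p × p < r)
  split q<p₁ p₁<p₂ p₂<r (no 0≮p₁) =
    let t , tx = inhabitedˡ x
        p , p≤ = small t
    in inj₁ (t , p , tx , p≤ , ℚ.<-trans (ℚ.<-≤-trans q<p₁ (ℚ.≮⇒≥ 0≮p₁)) (proj₁ p≤))
  split q<p₁ p₁<p₂ p₂<r (yes 0<p₁) =
    let n , 2p₁ᵐ≤p₂ᵐ               = double 0<p₁ p₁<p₂
        s , t , sx , tx , t<s+1/m = approx x (recip-pos n)
    in decide n s t q<p₁ p₁<p₂ p₂<r 0<p₁ 2p₁ᵐ≤p₂ᵐ sx tx t<s+1/m (_ ℚ.≤? _)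

  loc : ∀ {q r} → q < r →
        (∃₂ λ t p → lower x t × p ≤2^ t × q < p) ⊎
        (∃₂ λ t p → upper x t × 2^ t ≤ p × p < r)
  loc {q} {r} q<r =
    let p₂ , q<p₂ , p₂<r  = ℚ.<-dense q<r
        p₁ , q<p₁ , p₁<p₂ = ℚ.<-dense q<p₂
    in split q<p₁ p₁<p₂ p₂<r (0ℚ ℚ.<? p₁)

module _ where

  open import Algebra.Properties.Monoid.Sum ℚ.+-0-monoid using (sum; sum-syntax)

  -- Lower and upper Darboux sums of ∫₁ⁿ dt/t for the partition of [1,n]
  -- into intervals of length 1/m, m = k+1: the points are 1 + i/m, and
  -- (1/m) · 1/(1 + i/m) = 1/(m+i).

  darbouxˡ darbouxᵘ : ℕ → ℕ → ℚ
  darbouxˡ n k = ∑[ i < pred n ℕ.* suc k ] (+ 1 / (suc k ℕ.+ suc (toℕ i)))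
  darbouxᵘ n k = ∑[ i < pred n ℕ.* suc k ] (+ 1 / (suc k ℕ.+ toℕ i))

  ∑ : ℕ → (ℕ → ℚ) → ℚ
  ∑ n f = ∑[ i < n ] f (toℕ i)

  module _ (_∼_ : ℚ → ℚ → Set) (∼-refl : ∀ {p} → p ∼ p)
           (∼-trans : ∀ {p q r} → p ∼ q → q ∼ r → p ∼ r)
           (+-mono : ∀ {p q r s} → p ∼ q → r ∼ s → (p + r) ∼ (q + s)) where

    ∑-mono : ∀ n {f g : ℕ → ℚ} → (∀ i → f i ∼ g i) → ∑ n f ∼ ∑ n g
    ∑-mono zero    f∼g = ∼-refl
    ∑-mono (suc n) f∼g = +-mono (f∼g 0) (∑-mono n (f∼g ∘ suc))

    ·-∑-mono : ∀ n {p} {f : ℕ → ℚ} → (∀ i → i ℕ.< n → p ∼ f i) → (n · p) ∼ ∑ n f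
    ·-∑-mono zero    p∼f = ∼-refl
    ·-∑-mono (suc n) p∼f = +-mono (p∼f 0 (s≤s z≤n)) (·-∑-mono n λ i i<n → p∼f (suc i) (s≤s i<n))

    ∑-blocks : ∀ m n {g f : ℕ → ℚ} →
               (∀ a b → b ℕ.< n → g a ∼ f (a ℕ.* n ℕ.+ b)) →
               ∑ m (λ a → n · g a) ∼ ∑ (m ℕ.* n) f
    ∑-blocks zero    n g∼f = ∼-refl
    ∑-blocks (suc m) n {g} {f} g∼f = subst (∑ (suc m) (λ a → n · g a) ∼_)
      (sym (∑-split n (m ℕ.* n) f))
      (+-mono (·-∑-mono n (g∼f 0))
              (∑-blocks m n {g ∘ suc} {f ∘ (n ℕ.+_)} λ a b b<n →
                subst (λ i → g (suc a) ∼ f i) (ℕ.+-assoc n (a ℕ.* n) b) (g∼f (suc a) b b<n)))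
      where
      ∑-split : ∀ m n f → ∑ (m ℕ.+ n) f ≡ ∑ m f + ∑ n (f ∘ (m ℕ.+_))
      ∑-split zero    n f = sym (ℚ.+-identityˡ _)
      ∑-split (suc m) n f = trans (cong (λ z → f 0 + z) (∑-split m n (f ∘ suc)))
                                  (sym (ℚ.+-assoc (f 0) _ _))

  ∑-cong : ∀ n {f g : ℕ → ℚ} → (∀ i → f i ≡ g i) → ∑ n f ≡ ∑ n g
  ∑-cong = ∑-mono _≡_ refl trans (cong₂ _+_)

  ∑-telescope : ∀ n (f : ℕ → ℚ) → ∑ n f + f n ≡ ∑ n (f ∘ suc) + f 0
  ∑-telescope zero    f = refl
  ∑-telescope (suc n) f = begin
    f 0 + ∑ n (f ∘ suc) + f (suc n)               ≡⟨ ℚ.+-assoc (f 0) _ _ ⟩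
    f 0 + (∑ n (f ∘ suc) + f (suc n))             ≡⟨ ℚ.+-comm (f 0) _ ⟩
    ∑ n (f ∘ suc) + f (suc n) + f 0               ≡⟨ cong (_+ f 0) (∑-telescope n (f ∘ suc)) ⟩
    ∑ n (f ∘ suc ∘ suc) + f 1 + f 0               ≡⟨ cong (_+ f 0) (ℚ.+-comm _ (f 1)) ⟩
    f 1 + ∑ n (f ∘ suc ∘ suc) + f 0               ∎
    where open ≡-Reasoning

  recip-antimono : ∀ {m n} → m ℕ.≤ n → + 1 / suc n ≤ + 1 / suc m
  recip-antimono {m} {n} m≤n = ℚ.toℚᵘ-cancel-≤
    (ℚᵘ.≤-respˡ-≃ (ℚᵘ.≃-sym (ℚ.toℚᵘ-fromℚᵘ (mkℚᵘ (+ 1) n)))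
    (ℚᵘ.≤-respʳ-≃ (ℚᵘ.≃-sym (ℚ.toℚᵘ-fromℚᵘ (mkℚᵘ (+ 1) m)))
    (*≤* (ℤ.*-monoˡ-≤-nonNeg (+ 1) (ℤ.+≤+ (s≤s m≤n))))))

  darbouxˡ≤darbouxᵘ : ∀ n k → darbouxˡ n k ≤ darbouxᵘ n k
  darbouxˡ≤darbouxᵘ n k =
    ∑-mono _≤_ ℚ.≤-refl ℚ.≤-trans ℚ.+-mono-≤ (pred n ℕ.* suc k)
      {λ i → + 1 / (suc k ℕ.+ suc i)} {λ i → + 1 / (suc k ℕ.+ i)}
      λ i → recip-antimono (ℕ.+-monoʳ-≤ k (ℕ.n≤1+n i))

  darbouxᵘ≤darbouxˡ+1/m : ∀ n k → darbouxᵘ n k ≤ darbouxˡ n k + + 1 / suc k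
  darbouxᵘ≤darbouxˡ+1/m n k = begin
    darbouxᵘ n k                    ≡⟨ ℚ.+-identityʳ _ ⟨
    darbouxᵘ n k + 0ℚ               ≤⟨ ℚ.+-monoʳ-≤ (darbouxᵘ n k) (ℚ.<⇒≤ (recip-pos (k ℕ.+ K))) ⟩
    darbouxᵘ n k + f K              ≡⟨ ∑-telescope K f ⟩
    darbouxˡ n k + f 0              ≡⟨ cong (λ j → darbouxˡ n k + + 1 / suc j) (ℕ.+-identityʳ k) ⟩
    darbouxˡ n k + + 1 / suc k      ∎
    where
    open ℚ.≤-Reasoning
    K : ℕ
    K = pred n ℕ.* suc k
    f : ℕ → ℚ
    f i = + 1 / (suc k ℕ.+ i)

  -- Refining each interval of length 1/(k+1) into j+1 pieces gives mesh
  -- 1/((k+1)(j+1)).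

  refined : ℕ → ℕ → ℕ
  refined k j = pred (suc k ℕ.* suc j)

  module _ (n k j : ℕ) where

    private
      M J : ℕ
      M = pred n ℕ.* suc k
      J = suc j

      count : M ℕ.* J ≡ pred n ℕ.* (suc k ℕ.* J)
      count = ℕ.*-assoc (pred n) (suc k) J

    darbouxˡ-refine : darbouxˡ n k ≤ darbouxˡ n (refined k j)
    darbouxˡ-refine = begin
      darbouxˡ n k                  ≡⟨ ∑-cong M (λ a → ·-recip J (k ℕ.+ suc a) refl) ⟨
      ∑ M (λ a → J · g a)           ≤⟨ ∑-blocks _≤_ ℚ.≤-refl ℚ.≤-trans ℚ.+-mono-≤ M J {g} {f} g≤f ⟩
      ∑ (M ℕ.* J) f                 ≡⟨ cong (λ m → ∑ m f) count ⟩
      darbouxˡ n (refined k j)      ∎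
      where
      open ℚ.≤-Reasoning
      g f : ℕ → ℚ
      g a = + 1 / ((suc k ℕ.+ suc a) ℕ.* J)
      f i = + 1 / (suc k ℕ.* J ℕ.+ suc i)
      g≤f : ∀ a b → b ℕ.< J → g a ≤ f (a ℕ.* J ℕ.+ b)
      g≤f a b b<J = recip-antimono (ℕ.s≤s⁻¹ (ℕ.≤-trans
        (ℕ.+-monoʳ-≤ (suc k ℕ.* J)
          (ℕ.≤-trans (ℕ.≤-reflexive (sym (ℕ.+-suc (a ℕ.* J) b)))
          (ℕ.≤-trans (ℕ.+-monoʳ-≤ (a ℕ.* J) b<J)
                     (ℕ.≤-reflexive (ℕ.+-comm (a ℕ.* J) J)))))
        (ℕ.≤-reflexive (sym (ℕ.*-distribʳ-+ J (suc k) (suc a))))))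

    darbouxᵘ-refine : darbouxᵘ n (refined k j) ≤ darbouxᵘ n k
    darbouxᵘ-refine = begin
      darbouxᵘ n (refined k j)      ≡⟨ cong (λ m → ∑ m f) count ⟨
      ∑ (M ℕ.* J) f                 ≤⟨ ∑-blocks (λ p q → q ≤ p) ℚ.≤-refl (λ q≤p r≤q → ℚ.≤-trans r≤q q≤p)
                                         ℚ.+-mono-≤ M J {g} {f} f≤g ⟩
      ∑ M (λ a → J · g a)           ≡⟨ ∑-cong M (λ a → ·-recip J (k ℕ.+ a) refl) ⟩
      darbouxᵘ n k                  ∎
      where
      open ℚ.≤-Reasoning
      g f : ℕ → ℚ
      g a = + 1 / ((suc k ℕ.+ a) ℕ.* J)
      f i = + 1 / (suc k ℕ.* J ℕ.+ i)
      f≤g : ∀ a b → b ℕ.< J → f (a ℕ.* J ℕ.+ b) ≤ g a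
      f≤g a b _ = recip-antimono (ℕ.s≤s⁻¹ (ℕ.≤-trans
        (ℕ.≤-reflexive (ℕ.*-distribʳ-+ J (suc k) a))
        (ℕ.+-monoʳ-≤ (suc k ℕ.* J) (ℕ.m≤m+n (a ℕ.* J) b))))

  darboux-≤ : ∀ n k j → darbouxˡ n k ≤ darbouxᵘ n j
  darboux-≤ n k j = begin
    darbouxˡ n k              ≤⟨ darbouxˡ-refine n k j ⟩
    darbouxˡ n (refined k j)  ≤⟨ darbouxˡ≤darbouxᵘ n (refined k j) ⟩
    darbouxᵘ n (refined k j)  ≡⟨ cong (λ m → darbouxᵘ n (pred m)) (ℕ.*-comm (suc k) (suc j)) ⟩
    darbouxᵘ n (refined j k)  ≤⟨ darbouxᵘ-refine n j k ⟩
    darbouxᵘ n j              ∎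
    where open ℚ.≤-Reasoning

log : (n : ℕ) → .{{NonZero n}} → ℝ
log n = record
  { lower      = λ q → ∃[ k ] q < darbouxˡ n k
  ; upper      = λ q → ∃[ k ] darbouxᵘ n k < q
  ; inhabitedˡ = let q , q<l = inhabitedˡ (fromℚ (darbouxˡ n 0)) in q , 0 , q<l
  ; inhabitedᵘ = let q , u<q = inhabitedᵘ (fromℚ (darbouxᵘ n 0)) in q , 0 , u<q
  ; closedˡ    = λ { p<q (k , q<l) → k , ℚ.<-trans p<q q<l }
  ; closedᵘ    = λ { p<q (k , u<p) → k , ℚ.<-trans u<p p<q }
  ; roundedˡ   = λ { (k , p<l) → let q , p<q , q<l = ℚ.<-dense p<l in q , p<q , k , q<l }
  ; roundedᵘ   = λ { (k , u<q) → let p , u<p , p<q = ℚ.<-dense u<q in p , p<q , k , u<p }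
  ; disjoint   = λ { (k , q<l) (j , u<q) →
      ℚ.<-irrefl refl (ℚ.<-≤-trans (ℚ.<-trans u<q q<l) (darboux-≤ n k j)) }
  ; located    = λ {p} {q} p<q →
      let k , 1/m<q-p = recip-small (p<q⇒0<q-p p<q) in decide p q k 1/m<q-p (p ℚ.<? darbouxˡ n k)
  }
  where
  cancel : ∀ p q → p + (q - p) ≡ q
  cancel = solve 2 (λ p q → p :+ (q :- p) := q) refl
    where open ℚ.+-*-Solver
  decide : ∀ p q k → + 1 / suc k < q - p → Dec (p < darbouxˡ n k) →
           (∃[ k ] p < darbouxˡ n k) ⊎ (∃[ k ] darbouxᵘ n k < q)
  decide p q k 1/m<q-p (yes p<l) = inj₁ (k , p<l)
  decide p q k 1/m<q-p (no  p≮l) = inj₂ (k , (begin-strict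
    darbouxᵘ n k                ≤⟨ darbouxᵘ≤darbouxˡ+1/m n k ⟩
    darbouxˡ n k + + 1 / suc k  ≤⟨ ℚ.+-monoˡ-≤ (+ 1 / suc k) (ℚ.≮⇒≥ p≮l) ⟩
    p + + 1 / suc k             <⟨ ℚ.+-monoʳ-< p 1/m<q-p ⟩
    p + (q - p)                 ≡⟨ cancel p q ⟩
    q                           ∎))
    where open ℚ.≤-Reasoning

RealFunction : Set₁
RealFunction = (N : ℕ) → .{{NonZero N}} → ℝ

TendsTo∞ : RealFunction → Set
TendsTo∞ r = ∀ (K : ℚ) → ∃[ N₀ ] ∀ N → .{{_ : NonZero N}} → N₀ ℕ.≤ N → fromℚ K ≤ᴿ r N

TendsTo0 : RealFunction → Set
TendsTo0 ε = ∀ (δ : ℚ) → 0ℚ < δ → ∃[ N₀ ] ∀ N → .{{_ : NonZero N}} → N₀ ℕ.≤ N →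
             (fromℚ (- δ) ≤ᴿ ε N) × (ε N ≤ᴿ fromℚ δ)

{-# OPTIONS --safe #-}
module Submission where

-- A word of length N ≥ k satisfying a given monic recurrence of order k is
-- determined by its first k letters, so at most 2ᵏ · 2ᵏ⁺¹ words have a recurrence
-- of order k, and the same holds for their reverses.  For K = ⌊N/2⌋, summing
--   K ≤ Lˢʸᵐ(s) + ∑_{k<K} ([s has a recurrence of order k] + [sʳᵉᵛ has one])
-- over all s gives E(Lˢʸᵐ) ≥ K - 2, and convexity of 2ˣ gives E(2^Lˢʸᵐ) ≥ 2^(K-2).
-- Both bounds are N/2 - O(1), whereas r and log tend to infinity, so that ε can be
-- taken to be 0 for all large N.

open import Defs
open import Algebra.Bundles using (CommutativeRing)
open import Data.Bool.Base using (true; false; _∧_; _xor_)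
import Data.Bool.Properties as Bool
open import Data.Fin.Base as Fin using (Fin; toℕ; fromℕ; fromℕ<; inject₁; inject≤)
import Data.Fin.Induction as Fin
import Data.Fin.Properties as Fin
open import Data.Fin.Subset.Properties using (anySubset?)
import Data.Integer.Base as ℤ
import Data.Integer.Properties as ℤ
open import Data.Nat.Base as ℕ using (ℕ; zero; suc; NonZero; ⌊_/2⌋; z≤n; s≤s)
import Data.Nat.Coprimality as Coprimality
import Data.Nat.Properties as ℕ
open import Data.Product.Base using (∃; _×_; _,_; proj₁; proj₂; Σ-syntax)
import Data.Rational.Base as ℚ
import Data.Rational.Properties as ℚ
open import Data.Rational.Unnormalised.Base using (mkℚᵘ; *≡*; *≤*)
import Data.Rational.Unnormalised.Properties as ℚᵘ
open import Data.Sum.Base as Sum using (_⊎_; inj₁; inj₂)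
open import Data.Vec.Base using (Vec; []; _∷_; head; tail; lookup; reverse; tabulate)
open import Data.Vec.Properties using (lookup∘tabulate; tabulate∘lookup; tabulate-cong; reverse-injective)
open import Function.Base using (_∘_; id)
open import Function.Definitions using (Injective)
open import Induction.WellFounded using (Acc; acc)
open import Level using (0ℓ)
open import Relation.Binary.PropositionalEquality hiding (J)
open import Relation.Nullary using (Dec; yes; no; contradiction)
open import Relation.Nullary.Decidable using (_×-dec_; toWitness)
open import Relation.Unary using (Pred; Decidable)

open import Algebra.Properties.Monoid.Mult ℚ.+-0-monoid using () renaming (_×_ to _·_)

module _ where

  open import Data.Nat.Base using (_+_; _*_; _∸_; _^_; _⊓_; _≤_; _<_; _≤′_; ≤′-refl; ≤′-step)
  open import Data.Nat.Properties
  open import Data.Nat.Solver using (module +-*-Solver)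
  open CommutativeRing Bool.xor-∧-commutativeRing using (+-commutativeMonoid; ring)
  open import Algebra.Properties.CommutativeMonoid.Sum +-commutativeMonoid using (sum; sum-cong-≗)
  open import Algebra.Properties.Ring ring using (+-cancelˡ)

  -- Sums over all binary words

  ∑𝔽₂^-mono : ∀ N {f g : Vec 𝔽₂ N → ℕ} → (∀ s → f s ≤ g s) → ∑𝔽₂^ N f ≤ ∑𝔽₂^ N g
  ∑𝔽₂^-mono zero    f≤g = f≤g []
  ∑𝔽₂^-mono (suc N) f≤g = +-mono-≤ (∑𝔽₂^-mono N (f≤g ∘ (false ∷_))) (∑𝔽₂^-mono N (f≤g ∘ (true ∷_)))

  ∑𝔽₂^-const : ∀ N x → ∑𝔽₂^ N (λ _ → x) ≡ x * 2 ^ N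
  ∑𝔽₂^-const zero    x = sym (*-identityʳ x)
  ∑𝔽₂^-const (suc N) x = trans (cong₂ _+_ (∑𝔽₂^-const N x) (∑𝔽₂^-const N x))
    (solve 2 (λ x p → x :* p :+ x :* p := x :* (con 2 :* p)) refl x (2 ^ N))
    where open +-*-Solver

  ∑𝔽₂^-+ : ∀ N (f g : Vec 𝔽₂ N → ℕ) → ∑𝔽₂^ N (λ s → f s + g s) ≡ ∑𝔽₂^ N f + ∑𝔽₂^ N g
  ∑𝔽₂^-+ zero    f g = refl
  ∑𝔽₂^-+ (suc N) f g = trans
    (cong₂ _+_ (∑𝔽₂^-+ N (f ∘ (false ∷_)) (g ∘ (false ∷_))) (∑𝔽₂^-+ N (f ∘ (true ∷_)) (g ∘ (true ∷_))))
    (solve 4 (λ a b c d → a :+ b :+ (c :+ d) := a :+ c :+ (b :+ d)) refl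
      (∑𝔽₂^ N (f ∘ (false ∷_))) (∑𝔽₂^ N (g ∘ (false ∷_))) (∑𝔽₂^ N (f ∘ (true ∷_))) (∑𝔽₂^ N (g ∘ (true ∷_))))
    where open +-*-Solver

  ∑𝔽₂^-*ˡ : ∀ N x (f : Vec 𝔽₂ N → ℕ) → ∑𝔽₂^ N (λ s → x * f s) ≡ x * ∑𝔽₂^ N f
  ∑𝔽₂^-*ˡ zero    x f = refl
  ∑𝔽₂^-*ˡ (suc N) x f = trans (cong₂ _+_ (∑𝔽₂^-*ˡ N x (f ∘ (false ∷_))) (∑𝔽₂^-*ˡ N x (f ∘ (true ∷_))))
    (sym (*-distribˡ-+ x (∑𝔽₂^ N (f ∘ (false ∷_))) (∑𝔽₂^ N (f ∘ (true ∷_)))))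

  ∑𝔽₂^-swap : ∀ M N (f : Vec 𝔽₂ M → Vec 𝔽₂ N → ℕ) →
              ∑𝔽₂^ M (λ s → ∑𝔽₂^ N (f s)) ≡ ∑𝔽₂^ N (λ t → ∑𝔽₂^ M (λ s → f s t))
  ∑𝔽₂^-swap zero    N f = refl
  ∑𝔽₂^-swap (suc M) N f = trans
    (cong₂ _+_ (∑𝔽₂^-swap M N (f ∘ (false ∷_))) (∑𝔽₂^-swap M N (f ∘ (true ∷_))))
    (sym (∑𝔽₂^-+ N _ _))

  term≤∑𝔽₂^ : ∀ {N} (f : Vec 𝔽₂ N → ℕ) s → f s ≤ ∑𝔽₂^ N f
  term≤∑𝔽₂^ f []          = ≤-refl
  term≤∑𝔽₂^ f (false ∷ s) = ≤-trans (term≤∑𝔽₂^ (f ∘ (false ∷_)) s) (m≤m+n _ _)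
  term≤∑𝔽₂^ f (true ∷ s)  = ≤-trans (term≤∑𝔽₂^ (f ∘ (true ∷_)) s) (m≤n+m _ _)

  -- Counting words through an injective map

  𝟙 : ∀ {A : Set} → Dec A → ℕ
  𝟙 (yes _) = 1
  𝟙 (no  _) = 0

  𝟙-yes : ∀ {A : Set} (A? : Dec A) → A → 𝟙 A? ≡ 1
  𝟙-yes (yes _) a = refl
  𝟙-yes (no ¬a) a = contradiction a ¬a

  count : ∀ {N} {P : Pred (Vec 𝔽₂ N) 0ℓ} → Decidable P → ℕ
  count {N} P? = ∑𝔽₂^ N (𝟙 ∘ P?)

  count-split : ∀ {M N} {P : Pred (Vec 𝔽₂ N) 0ℓ} (P? : Decidable P) (h : Vec 𝔽₂ N → Vec 𝔽₂ (suc M)) →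
                count P? ≤ count (λ s → P? s ×-dec head (h s) Bool.≟ false) +
                           count (λ s → P? s ×-dec head (h s) Bool.≟ true)
  count-split {N = N} P? h = ≤-trans (∑𝔽₂^-mono N pointwise) (≤-reflexive (∑𝔽₂^-+ N _ _))
    where
    pointwise : ∀ s → 𝟙 (P? s) ≤ 𝟙 (P? s ×-dec head (h s) Bool.≟ false) +
                                 𝟙 (P? s ×-dec head (h s) Bool.≟ true)
    pointwise s with P? s | head (h s)
    ... | no _  | _     = z≤n
    ... | yes _ | false = ≤-refl
    ... | yes _ | true  = ≤-refl

  count-subsingleton : ∀ {N} {P : Pred (Vec 𝔽₂ N) 0ℓ} (P? : Decidable P) →
                       (∀ s t → P s → P t → s ≡ t) → count P? ≤ 1
  count-subsingleton {zero}  P? unique with P? []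
  ... | yes _ = ≤-refl
  ... | no  _ = z≤n
  count-subsingleton {suc N} {P} P? unique with anyTrue
    where
    anyTrue : Dec (∃ λ s → P (true ∷ s))
    -- Subsets of `Fin N` are Boolean vectors, so `anySubset?` searches all words of length `N`. A
    -- word of `P` starting with `true` rules out every word of `P` starting with `false`.
    anyTrue = anySubset? (λ s → P? (true ∷ s))
  ... | yes (t , pt) = +-mono-≤ {∑𝔽₂^ N (𝟙 ∘ P? ∘ (false ∷_))} {0} {∑𝔽₂^ N (𝟙 ∘ P? ∘ (true ∷_))} {1}
          (≤-trans (∑𝔽₂^-mono N noFalse) (≤-reflexive (∑𝔽₂^-const N 0)))
          (count-subsingleton (P? ∘ (true ∷_)) λ s s′ p p′ → cong tail (unique _ _ p p′))
    where
    noFalse : ∀ s → 𝟙 (P? (false ∷ s)) ≤ 0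
    noFalse s with P? (false ∷ s)
    ... | no  _ = z≤n
    ... | yes p with () ← unique _ _ p pt
  ... | no ¬t = +-mono-≤ {_} {1} {∑𝔽₂^ N (𝟙 ∘ P? ∘ (true ∷_))} {0}
          (count-subsingleton (P? ∘ (false ∷_)) λ s s′ p p′ → cong tail (unique _ _ p p′))
          (≤-trans (∑𝔽₂^-mono N noTrue) (≤-reflexive (∑𝔽₂^-const N 0)))
    where
    noTrue : ∀ s → 𝟙 (P? (true ∷ s)) ≤ 0
    noTrue s with P? (true ∷ s)
    ... | no  _ = z≤n
    ... | yes p = contradiction (s , p) ¬t

  -- Induction on `M`: split the counted words by the first letter of `h s`. On each half that
  -- letter is fixed, so `tail ∘ h` is still injective there. Injectivity is required only on `P` so
  -- that this refinement of `P` stays within the hypothesis.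
  count-injective : ∀ {M N} {P : Pred (Vec 𝔽₂ N) 0ℓ} (P? : Decidable P) (h : Vec 𝔽₂ N → Vec 𝔽₂ M) →
                    (∀ s t → P s → P t → h s ≡ h t → s ≡ t) → count P? ≤ 2 ^ M
  count-injective {zero}  P? h inj = count-subsingleton P? λ s t p q → inj s t p q (empty _ _)
    where
    empty : ∀ (u v : Vec 𝔽₂ 0) → u ≡ v
    empty [] [] = refl
  count-injective {suc M} {N} {P} P? h inj = begin
    count P?                                                       ≤⟨ count-split P? h ⟩
    count (λ s → P? s ×-dec head (h s) Bool.≟ false) +
    count (λ s → P? s ×-dec head (h s) Bool.≟ true)                ≤⟨ +-mono-≤ (half false) (half true) ⟩
    2 ^ M + 2 ^ M                                                  ≡⟨ cong (2 ^ M +_) (+-identityʳ (2 ^ M)) ⟨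
    2 ^ suc M                                                      ∎
    where
    open ≤-Reasoning
    ∷-η : ∀ {b} (u v : Vec 𝔽₂ (suc M)) → head u ≡ b → head v ≡ b → tail u ≡ tail v → u ≡ v
    ∷-η (_ ∷ _) (_ ∷ _) refl refl refl = refl
    half : ∀ b → count (λ s → P? s ×-dec head (h s) Bool.≟ b) ≤ 2 ^ M
    half b = count-injective (λ s → P? s ×-dec head (h s) Bool.≟ b) (tail ∘ h)
      λ { s t (p , hs) (q , ht) eq → inj s t p q (∷-η (h s) (h t) hs ht eq) }

  -- Words with a recurrence of given order

  toℕ-shift : ∀ {N L} (n : Fin (N ∸ L)) (ℓ : Fin (suc L)) → toℕ (shift n ℓ) ≡ toℕ n + toℕ ℓ
  toℕ-shift n ℓ = Fin.toℕ-fromℕ< _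

  sum-cancel-init : ∀ n (f g : Fin (suc n) → 𝔽₂) → sum f ≡ sum g →
                    (∀ j → f (inject₁ j) ≡ g (inject₁ j)) → f (fromℕ n) ≡ g (fromℕ n)
  sum-cancel-init zero    f g ∑f≡∑g f≡g =
    trans (sym (Bool.xor-identityʳ _)) (trans ∑f≡∑g (Bool.xor-identityʳ _))
  sum-cancel-init (suc n) f g ∑f≡∑g f≡g = sum-cancel-init n (f ∘ Fin.suc) (g ∘ Fin.suc)
    (+-cancelˡ (g Fin.zero) _ _ (subst (λ x → x xor sum (f ∘ Fin.suc) ≡ sum g) (f≡g Fin.zero) ∑f≡∑g))
    (f≡g ∘ Fin.suc)

  module _ {N k : ℕ} (c : Vec 𝔽₂ (suc k)) (c-monic : lookup c (fromℕ k) ≡ true) where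

    -- For `i ≥ k` the relation at offset `n = i - k` has position `i` as its last one. Its leading
    -- coefficient is 1, so it expresses the letter at `i` through the `k` letters before it; these
    -- agree by well-founded induction.
    annihilated-determined : (s t : Vec 𝔽₂ N) → Annihilates c s → Annihilates c t →
                             (∀ i → toℕ i < k → lookup s i ≡ lookup t i) → ∀ i → lookup s i ≡ lookup t i
    annihilated-determined s t cs ct init i = go i (Fin.<-wellFounded i)
      where
      go : ∀ i → Acc Fin._<_ i → lookup s i ≡ lookup t i
      go i (acc rec) with toℕ i <? k
      ... | yes i<k = init i i<k
      ... | no  i≮k = begin
        lookup s i                                             ≡⟨ last s ⟨
        lookup c (fromℕ k) ∧ lookup s (shift n (fromℕ k))      ≡⟨ sum-cancel-init k
                                                                    (λ ℓ → lookup c ℓ ∧ lookup s (shift n ℓ))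
                                                                    (λ ℓ → lookup c ℓ ∧ lookup t (shift n ℓ))
                                                                    (trans (cs n) (sym (ct n))) earlier ⟩
        lookup c (fromℕ k) ∧ lookup t (shift n (fromℕ k))      ≡⟨ last t ⟩
        lookup t i                                             ∎
        where
        open ≡-Reasoning
        k≤i : k ≤ toℕ i
        k≤i = ≮⇒≥ i≮k
        i-k<N-k : toℕ i ∸ k < N ∸ k
        i-k<N-k = ∸-monoˡ-< (Fin.toℕ<n i) k≤i
        n : Fin (N ∸ k)
        n = fromℕ< i-k<N-k
        toℕ-n : toℕ n + k ≡ toℕ i
        toℕ-n = trans (cong (_+ k) (Fin.toℕ-fromℕ< i-k<N-k)) (m∸n+n≡m k≤i)
        last : ∀ u → lookup c (fromℕ k) ∧ lookup u (shift n (fromℕ k)) ≡ lookup u i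
        last u = cong₂ (λ b j → b ∧ lookup u j) c-monic (Fin.toℕ-injective
          (trans (toℕ-shift n (fromℕ k)) (trans (cong (toℕ n +_) (Fin.toℕ-fromℕ k)) toℕ-n)))
        earlier : ∀ j → lookup c (inject₁ j) ∧ lookup s (shift n (inject₁ j)) ≡
                        lookup c (inject₁ j) ∧ lookup t (shift n (inject₁ j))
        earlier j = cong (lookup c (inject₁ j) ∧_) (go _ (rec (subst₂ _<_
          (sym (trans (toℕ-shift n (inject₁ j)) (cong (toℕ n +_) (Fin.toℕ-inject₁ j)))) toℕ-n
          (+-monoʳ-< (toℕ n) (Fin.toℕ<n j)))))

  monicAnnihilator? : ∀ {N k} (c : Vec 𝔽₂ (suc k)) (s : Vec 𝔽₂ N) →
                      Dec (lookup c (fromℕ k) ≡ true × Annihilates c s)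
  monicAnnihilator? {k = k} c s = lookup c (fromℕ k) Bool.≟ true ×-dec Fin.all? λ n → _ Bool.≟ false

  module _ {N k : ℕ} (k≤N : k ≤ N) (φ : Vec 𝔽₂ N → Vec 𝔽₂ N) (φ-inj : Injective _≡_ _≡_ φ) where

    -- The prefix of length `k` is an injective invariant of the annihilated words. Taking `φ` to be
    -- `id` or `reverse` later covers words and their reverses with one argument.
    count-annihilated : (c : Vec 𝔽₂ (suc k)) → count (λ s → monicAnnihilator? c (φ s)) ≤ 2 ^ k
    count-annihilated c = count-injective (λ s → monicAnnihilator? c (φ s)) (prefix ∘ φ)
      λ { s t (monic , cs) (_ , ct) eq → φ-inj (lookup-ext
          (annihilated-determined c monic (φ s) (φ t) cs ct (agree (φ s) (φ t) eq))) }
      where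
      prefix : Vec 𝔽₂ N → Vec 𝔽₂ k
      prefix s = tabulate λ i → lookup s (inject≤ i k≤N)
      lookup-ext : ∀ {s t : Vec 𝔽₂ N} → (∀ i → lookup s i ≡ lookup t i) → s ≡ t
      lookup-ext eq = trans (sym (tabulate∘lookup _)) (trans (tabulate-cong eq) (tabulate∘lookup _))
      agree : ∀ s t → prefix s ≡ prefix t → ∀ i → toℕ i < k → lookup s i ≡ lookup t i
      agree s t eq i i<k = subst (λ i → lookup s i ≡ lookup t i)
        (Fin.toℕ-injective (trans (Fin.toℕ-inject≤ (fromℕ< i<k) k≤N) (Fin.toℕ-fromℕ< i<k)))
        (trans (sym (lookup∘tabulate _ (fromℕ< i<k)))
          (trans (cong (λ u → lookup u (fromℕ< i<k)) eq) (lookup∘tabulate _ (fromℕ< i<k))))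

    -- Union bound over the coefficient vectors `c`: after the two sums are exchanged, each `c`
    -- contributes at most `2 ^ k` words.
    count-hasRecurrence : count (λ s → hasRecurrence? (φ s) k) ≤ 2 ^ k * 2 ^ suc k
    count-hasRecurrence = begin
      ∑𝔽₂^ N (λ s → 𝟙 (hasRecurrence? (φ s) k))        ≤⟨ ∑𝔽₂^-mono N union ⟩
      ∑𝔽₂^ N (λ s → ∑𝔽₂^ (suc k) (a s))                ≡⟨ ∑𝔽₂^-swap N (suc k) a ⟩
      ∑𝔽₂^ (suc k) (λ c → ∑𝔽₂^ N (λ s → a s c))        ≤⟨ ∑𝔽₂^-mono (suc k) count-annihilated ⟩
      ∑𝔽₂^ (suc k) (λ c → 2 ^ k)                       ≡⟨ ∑𝔽₂^-const (suc k) (2 ^ k) ⟩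
      2 ^ k * 2 ^ suc k                                ∎
      where
      open ≤-Reasoning
      a : Vec 𝔽₂ N → Vec 𝔽₂ (suc k) → ℕ
      a s c = 𝟙 (monicAnnihilator? c (φ s))
      union : ∀ s → 𝟙 (hasRecurrence? (φ s) k) ≤ ∑𝔽₂^ (suc k) (a s)
      union s with hasRecurrence? (φ s) k
      ... | no _         = z≤n
      ... | yes (c , cs) = ≤-trans (≤-reflexive (sym (𝟙-yes (monicAnnihilator? c (φ s)) cs)))
                                   (term≤∑𝔽₂^ (a s) c)

  -- Mean of the symmetric linear complexity

  -- Prepending a zero coefficient turns the new relation at `n` into the old relation at `n + 1`;
  -- the added first term of the sum vanishes by computation.
  hasRecurrence-suc : ∀ {N} (s : Vec 𝔽₂ N) {k} → HasRecurrence s k → HasRecurrence s (suc k)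
  hasRecurrence-suc {N} s {k} (c , monic , cs) = false ∷ c , monic , λ n →
    trans (sum-cong-≗ λ ℓ → cong (λ i → lookup c ℓ ∧ lookup s i) (Fin.toℕ-injective (same n ℓ))) (cs (n′ n))
    where
    bound : ∀ n → suc (toℕ {N ∸ suc k} n) < N ∸ k
    bound n = begin
      2 + toℕ n         ≤⟨ s≤s (Fin.toℕ<n n) ⟩
      suc (N ∸ suc k)   ≡⟨ +-∸-assoc 1 (<⇒≤ (m∸n≢0⇒n<m {N} {suc k} nonZero)) ⟨
      N ∸ k             ∎
      where
      open ≤-Reasoning
      nonZero : N ∸ suc k ≢ 0
      nonZero eq with () ← subst Fin eq n
    n′ : Fin (N ∸ suc k) → Fin (N ∸ k)
    n′ n = fromℕ< (bound n)
    same : ∀ n ℓ → toℕ (shift {N} n (Fin.suc ℓ)) ≡ toℕ (shift {N} (n′ n) ℓ)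
    same n ℓ = begin
      toℕ (shift {N} n (Fin.suc ℓ))   ≡⟨ toℕ-shift {N} n (Fin.suc ℓ) ⟩
      toℕ n + suc (toℕ ℓ)             ≡⟨ +-suc (toℕ n) (toℕ ℓ) ⟩
      suc (toℕ n) + toℕ ℓ             ≡⟨ cong (_+ toℕ ℓ) (Fin.toℕ-fromℕ< (bound n)) ⟨
      toℕ (n′ n) + toℕ ℓ              ≡⟨ toℕ-shift {N} (n′ n) ℓ ⟨
      toℕ (shift {N} (n′ n) ℓ)        ∎
      where open ≡-Reasoning

  hasRecurrence-≥L : ∀ {N} (s : Vec 𝔽₂ N) {k} → L s ≤ k → HasRecurrence s k
  hasRecurrence-≥L s = go ∘ ≤⇒≤′
    where
    go : ∀ {k} → L s ≤′ k → HasRecurrence s k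
    go ≤′-refl       = proj₁ (proj₂ (linearComplexity-least s))
    go (≤′-step L≤k) = hasRecurrence-suc s (go L≤k)

  layer : ∀ {N} → ℕ → Vec 𝔽₂ N → ℕ
  layer k s = 𝟙 (hasRecurrence? s k) + 𝟙 (hasRecurrence? (reverse s) k)

  layers : ∀ {N} → ℕ → Vec 𝔽₂ N → ℕ
  layers zero    s = 0
  layers (suc K) s = layer K s + layers K s

  1≤layer : ∀ {N} k (s : Vec 𝔽₂ N) → HasRecurrence s k ⊎ HasRecurrence (reverse s) k → 1 ≤ layer k s
  1≤layer k s (inj₁ r) = ≤-trans (≤-reflexive (sym (𝟙-yes (hasRecurrence? s k) r)))
                               (m≤m+n _ _)
  1≤layer k s (inj₂ r) = ≤-trans (≤-reflexive (sym (𝟙-yes (hasRecurrence? (reverse s) k) r)))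
                               (m≤n+m _ (𝟙 (hasRecurrence? s k)))

  m⊓n≤k⇒m≤k⊎n≤k : ∀ m n {k} → m ⊓ n ≤ k → m ≤ k ⊎ n ≤ k
  m⊓n≤k⇒m≤k⊎n≤k m n {k} m⊓n≤k = Sum.map
    (λ eq → subst (_≤ k) eq m⊓n≤k) (λ eq → subst (_≤ k) eq m⊓n≤k) (⊓-sel m n)

  Lˢʸᵐ≤k⇒1≤layer : ∀ {N} k (s : Vec 𝔽₂ N) → Lˢʸᵐ s ≤ k → 1 ≤ layer k s
  Lˢʸᵐ≤k⇒1≤layer k s L≤k = 1≤layer k s
    (Sum.map (hasRecurrence-≥L s) (hasRecurrence-≥L (reverse s))
             (m⊓n≤k⇒m≤k⊎n≤k (L s) (L (reverse s)) L≤k))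

  -- Each `k` with `Lˢʸᵐ s ≤ k < K` contributes at least 1 to `layers K s`, since recurrences
  -- persist above the linear complexity. In the induction, either `Lˢʸᵐ s` already exceeds `K`, or
  -- the new layer supplies the missing 1.
  K≤Lˢʸᵐ+layers : ∀ {N} K (s : Vec 𝔽₂ N) → K ≤ Lˢʸᵐ s + layers K s
  K≤Lˢʸᵐ+layers zero    s = z≤n
  K≤Lˢʸᵐ+layers (suc K) s = step (Lˢʸᵐ s) (layer K s) (layers K s)
    (Lˢʸᵐ≤k⇒1≤layer K s) (K≤Lˢʸᵐ+layers K s) (Lˢʸᵐ s ≤? K)
    where
    step : ∀ l x y → (l ≤ K → 1 ≤ x) → K ≤ l + y → Dec (l ≤ K) → suc K ≤ l + (x + y)
    step l x y _   _     (no  l≰K) = ≤-trans (≰⇒> l≰K) (m≤m+n l (x + y))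
    step l x y 1≤x K≤l+y (yes l≤K) = ≤-trans (+-mono-≤ (1≤x l≤K) K≤l+y)
      (≤-reflexive (solve 3 (λ l x y → x :+ (l :+ y) := l :+ (x :+ y)) refl l x y))
      where open +-*-Solver

  ∑-layers : ∀ {N} K → K ≤ N → ∑𝔽₂^ N (layers K) ≤ 2 * (2 ^ K * 2 ^ K)
  ∑-layers {N} zero    _     = ≤-trans (≤-reflexive (∑𝔽₂^-const N 0)) z≤n
  ∑-layers {N} (suc K) K<N = begin
    ∑𝔽₂^ N (layers (suc K))                                     ≡⟨ ∑𝔽₂^-+ N (layer K) (layers K) ⟩
    ∑𝔽₂^ N (layer K) + ∑𝔽₂^ N (layers K)                        ≡⟨ cong (_+ ∑𝔽₂^ N (layers K)) (∑𝔽₂^-+ N f (f ∘ reverse)) ⟩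
    ∑𝔽₂^ N f + ∑𝔽₂^ N (f ∘ reverse) + ∑𝔽₂^ N (layers K)         ≤⟨ +-mono-≤ (+-mono-≤
                                                                     (count-hasRecurrence (<⇒≤ K<N) id id)
                                                                     (count-hasRecurrence (<⇒≤ K<N) reverse reverse-injective))
                                                                     (∑-layers K (<⇒≤ K<N)) ⟩
    -- A geometric sum with ratio 4: the new layer adds at most `4x²` to the inductive `2x²`, which
    -- stays within the target `8x²`.
    x * (2 * x) + x * (2 * x) + 2 * (x * x)                     ≤⟨ m≤m+n _ (2 * (x * x)) ⟩
    x * (2 * x) + x * (2 * x) + 2 * (x * x) + 2 * (x * x)       ≡⟨ solve 1 (λ x →
      x :* (con 2 :* x) :+ x :* (con 2 :* x) :+ con 2 :* (x :* x) :+ con 2 :* (x :* x) :=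
      con 2 :* (con 2 :* x :* (con 2 :* x))) refl x ⟩
    2 * (2 * x * (2 * x))                                       ∎
    where
    open ≤-Reasoning
    open +-*-Solver
    x : ℕ
    x = 2 ^ K
    f : Vec 𝔽₂ N → ℕ
    f s = 𝟙 (hasRecurrence? s K)

  -- Since `2K ≤ N`, the bound `2 * 4^K` on the layers is at most `2 * 2 ^ N`, so they lower the
  -- mean by at most 2. Truncated subtraction only makes the claim trivial when `K < 2`.
  ∑Lˢʸᵐ-lower : ∀ N → (⌊ N /2⌋ ∸ 2) * 2 ^ N ≤ ∑𝔽₂^ N Lˢʸᵐ
  ∑Lˢʸᵐ-lower N = begin
    (K ∸ 2) * 2 ^ N            ≡⟨ *-distribʳ-∸ (2 ^ N) K 2 ⟩
    K * 2 ^ N ∸ 2 * 2 ^ N      ≤⟨ m≤n+o⇒m∸n≤o (K * 2 ^ N) (2 * 2 ^ N) total ⟩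
    ∑𝔽₂^ N Lˢʸᵐ                ∎
    where
    open ≤-Reasoning
    K : ℕ
    K = ⌊ N /2⌋
    K+K≤N : K + K ≤ N
    K+K≤N = ≤-trans (+-monoʳ-≤ K (⌊n/2⌋≤⌈n/2⌉ N)) (≤-reflexive (⌊n/2⌋+⌈n/2⌉≡n N))
    total : K * 2 ^ N ≤ 2 * 2 ^ N + ∑𝔽₂^ N Lˢʸᵐ
    total = begin
      K * 2 ^ N                                  ≡⟨ ∑𝔽₂^-const N K ⟨
      ∑𝔽₂^ N (λ _ → K)                           ≤⟨ ∑𝔽₂^-mono N (K≤Lˢʸᵐ+layers K) ⟩
      ∑𝔽₂^ N (λ s → Lˢʸᵐ s + layers K s)         ≡⟨ ∑𝔽₂^-+ N Lˢʸᵐ (layers K) ⟩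
      ∑𝔽₂^ N Lˢʸᵐ + ∑𝔽₂^ N (layers K)            ≤⟨ +-monoʳ-≤ (∑𝔽₂^ N Lˢʸᵐ) (∑-layers K (⌊n/2⌋≤n N)) ⟩
      ∑𝔽₂^ N Lˢʸᵐ + 2 * (2 ^ K * 2 ^ K)          ≡⟨ cong (λ x → ∑𝔽₂^ N Lˢʸᵐ + 2 * x) (^-distribˡ-+-* 2 K K) ⟨
      ∑𝔽₂^ N Lˢʸᵐ + 2 * 2 ^ (K + K)              ≤⟨ +-monoʳ-≤ (∑𝔽₂^ N Lˢʸᵐ) (*-monoʳ-≤ 2 (^-monoʳ-≤ 2 K+K≤N)) ⟩
      ∑𝔽₂^ N Lˢʸᵐ + 2 * 2 ^ N                    ≡⟨ +-comm (∑𝔽₂^ N Lˢʸᵐ) (2 * 2 ^ N) ⟩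
      2 * 2 ^ N + ∑𝔽₂^ N Lˢʸᵐ                    ∎

  -- Convexity of the exponential

  -- 1 + x ≤ 2ˣ at x = l - m, cleared of denominators and subtractions.

  2^-tangent : ∀ m l → suc l * 2 ^ m ≤ 2 ^ l + m * 2 ^ m
  2^-tangent zero l = begin
    suc l * 1       ≡⟨ *-identityʳ (suc l) ⟩
    suc l           ≤⟨ l<2^l l ⟩
    2 ^ l           ≡⟨ +-identityʳ (2 ^ l) ⟨
    2 ^ l + 0       ∎
    where
    open ≤-Reasoning
    l<2^l : ∀ l → l < 2 ^ l
    l<2^l zero    = s≤s z≤n
    l<2^l (suc l) = +-mono-≤ (m^n>0 2 l) (≤-trans (l<2^l l) (m≤m+n (2 ^ l) 0))
  2^-tangent (suc m) zero = ≤-trans (*-monoˡ-≤ (2 ^ suc m) (s≤s (z≤n {m}))) (m≤n+m _ 1)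
  -- The inequality depends on `l - m` up to a power of 2, so lowering both by 1 amounts to dividing
  -- it by 2.
  2^-tangent (suc m) (suc l) = begin
    (2 + l) * (2 * x)             ≡⟨ solve 2 (λ l x → (con 2 :+ l) :* (con 2 :* x) :=
                                       con 2 :* ((con 1 :+ l) :* x) :+ con 2 :* x) refl l x ⟩
    2 * (suc l * x) + 2 * x       ≤⟨ +-monoˡ-≤ (2 * x) (*-monoʳ-≤ 2 (2^-tangent m l)) ⟩
    2 * (2 ^ l + m * x) + 2 * x   ≡⟨ solve 3 (λ y m x → con 2 :* (y :+ m :* x) :+ con 2 :* x :=
                                       con 2 :* y :+ (con 1 :+ m) :* (con 2 :* x)) refl (2 ^ l) m x ⟩
    2 * 2 ^ l + suc m * (2 * x)   ∎
    where
    open ≤-Reasoning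
    open +-*-Solver
    x : ℕ
    x = 2 ^ m

  -- Jensen's inequality, by summing the tangent bound at `m` over all words. Adding
  -- `2 ^ m * (m * 2 ^ N)` to both sides avoids subtraction in the naturals.
  ∑2^-jensen : ∀ N m (f : Vec 𝔽₂ N → ℕ) → m * 2 ^ N ≤ ∑𝔽₂^ N f → 2 ^ m * 2 ^ N ≤ ∑𝔽₂^ N (λ s → 2 ^ f s)
  ∑2^-jensen N m f m≤f = +-cancelʳ-≤ (2 ^ m * (m * 2 ^ N)) _ _ (begin
    2 ^ m * 2 ^ N + 2 ^ m * (m * 2 ^ N)             ≤⟨ +-monoʳ-≤ (2 ^ m * 2 ^ N) (*-monoʳ-≤ (2 ^ m) m≤f) ⟩
    2 ^ m * 2 ^ N + 2 ^ m * ∑𝔽₂^ N f                ≡⟨ cong₂ _+_ (∑𝔽₂^-const N (2 ^ m)) (∑𝔽₂^-*ˡ N (2 ^ m) f) ⟨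
    ∑𝔽₂^ N (λ _ → 2 ^ m) + ∑𝔽₂^ N (λ s → 2 ^ m * f s)   ≡⟨ ∑𝔽₂^-+ N _ _ ⟨
    ∑𝔽₂^ N (λ s → 2 ^ m + 2 ^ m * f s)              ≤⟨ ∑𝔽₂^-mono N tangent ⟩
    ∑𝔽₂^ N (λ s → 2 ^ f s + m * 2 ^ m)              ≡⟨ ∑𝔽₂^-+ N _ _ ⟩
    ∑𝔽₂^ N (λ s → 2 ^ f s) + ∑𝔽₂^ N (λ _ → m * 2 ^ m)   ≡⟨ cong (∑𝔽₂^ N (λ s → 2 ^ f s) +_) (∑𝔽₂^-const N (m * 2 ^ m)) ⟩
    ∑𝔽₂^ N (λ s → 2 ^ f s) + m * 2 ^ m * 2 ^ N      ≡⟨ cong (∑𝔽₂^ N (λ s → 2 ^ f s) +_)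
                                                        (solve 3 (λ m x y → m :* x :* y := x :* (m :* y)) refl m (2 ^ m) (2 ^ N)) ⟩
    ∑𝔽₂^ N (λ s → 2 ^ f s) + 2 ^ m * (m * 2 ^ N)    ∎)
    where
    open ≤-Reasoning
    open +-*-Solver
    tangent : ∀ s → 2 ^ m + 2 ^ m * f s ≤ 2 ^ f s + m * 2 ^ m
    tangent s = ≤-trans (≤-reflexive (cong (2 ^ m +_) (*-comm (2 ^ m) (f s)))) (2^-tangent m (f s))

open ℝ
open import Data.Integer.Base using (+_)
open import Data.Rational.Base using (ℚ; mkℚ; _/_; 0ℚ; ½; _+_; _*_; -_; _-_; _<_; _≤_)
open import Data.Rational.Solver using (module +-*-Solver)
open import Algebra.Properties.CommutativeSemiring.Exp
  (CommutativeRing.commutativeSemiring ℚ.+-*-commutativeRing) using (_^_)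

-- Comparison of the integer bounds with rationals

-- Built directly with denominator 1 rather than by normalisation, so that numerator and denominator
-- compute for a variable `m`, as `2^_≤_` requires.
ℕ→ℚ : ℕ → ℚ
ℕ→ℚ m = mkℚ (+ m) 0 (Coprimality.sym (Coprimality.1-coprimeTo m))

ℕ→ℚ-≤-/ : ∀ m n d → .{{_ : NonZero d}} → m ℕ.* d ℕ.≤ n → ℕ→ℚ m ≤ + n / d
ℕ→ℚ-≤-/ m n (suc d) md≤n = ℚ.toℚᵘ-cancel-≤
  (ℚᵘ.≤-respʳ-≃ (ℚᵘ.≃-sym (ℚ.toℚᵘ-fromℚᵘ (mkℚᵘ (+ n) d)))
  (*≤* (subst₂ ℤ._≤_ (ℤ.pos-* m (suc d)) (sym (ℤ.*-identityʳ (+ n))) (ℤ.+≤+ md≤n))))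

ℕ→ℚ-≤-𝔼 : ∀ N m f → m ℕ.* 2 ℕ.^ N ℕ.≤ ∑𝔽₂^ N f → ℕ→ℚ m ≤ 𝔼 N f
ℕ→ℚ-≤-𝔼 N m f = ℕ→ℚ-≤-/ m (∑𝔽₂^ N f) (2 ℕ.^ N) {{ℕ.m^n≢0 2 N}}

3ℚ : ℚ
3ℚ = + 3 / 1

N≤2m+6⇒N/2-3≤m : ∀ N m → N ℕ.≤ (m ℕ.+ 3) ℕ.* 2 → + N / 2 - 3ℚ ≤ ℕ→ℚ m
N≤2m+6⇒N/2-3≤m N m N≤ = begin
  + N / 2 - 3ℚ               ≤⟨ ℚ.+-monoˡ-≤ (- 3ℚ) N/2≤m+3 ⟩
  ℕ→ℚ m + 3ℚ - 3ℚ            ≡⟨ solve 2 (λ x y → x :+ y :- y := x) refl (ℕ→ℚ m) 3ℚ ⟩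
  ℕ→ℚ m                      ∎
  where
  open ℚ.≤-Reasoning
  open +-*-Solver
  N/2≤m+3 : + N / 2 ≤ ℕ→ℚ m + 3ℚ
  N/2≤m+3 = ℚ.toℚᵘ-cancel-≤
    (ℚᵘ.≤-respˡ-≃ (ℚᵘ.≃-sym (ℚ.toℚᵘ-fromℚᵘ (mkℚᵘ (+ N) 1)))
    (ℚᵘ.≤-respʳ-≃ (ℚᵘ.≃-sym (ℚ.toℚᵘ-homo-+ (ℕ→ℚ m) 3ℚ))
    (*≤* (subst₂ ℤ._≤_ (sym (ℤ.*-identityʳ (+ N)))
      (trans (ℤ.pos-* (m ℕ.+ 3) 2) (cong (λ x → (x ℤ.+ + 3) ℤ.* + 2) (sym (ℤ.*-identityʳ (+ m)))))
      (ℤ.+≤+ N≤)))))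

-- With `K = ⌊ N /2⌋`, both `N ≤ 2K + 1` and `K ≤ (K ∸ 2) + 2` hold, so `N/2` exceeds `K ∸ 2` by at
-- most 5/2; 3 is the next integer.
N≤2[⌊N/2⌋∸2]+6 : ∀ N → N ℕ.≤ (⌊ N /2⌋ ℕ.∸ 2 ℕ.+ 3) ℕ.* 2
N≤2[⌊N/2⌋∸2]+6 0 = z≤n
N≤2[⌊N/2⌋∸2]+6 1 = toWitness {a? = 1 ℕ.≤? 6} _
N≤2[⌊N/2⌋∸2]+6 2 = toWitness {a? = 2 ℕ.≤? 6} _
N≤2[⌊N/2⌋∸2]+6 3 = toWitness {a? = 3 ℕ.≤? 6} _
N≤2[⌊N/2⌋∸2]+6 4 = toWitness {a? = 4 ℕ.≤? 6} _
N≤2[⌊N/2⌋∸2]+6 5 = toWitness {a? = 5 ℕ.≤? 6} _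
-- Here `⌊ N /2⌋ ≥ 2`, so the subtraction no longer truncates and two more letters raise
-- `⌊ N /2⌋ ∸ 2` by exactly 1.
N≤2[⌊N/2⌋∸2]+6 (suc (suc N@(suc (suc (suc (suc _)))))) = s≤s (s≤s (N≤2[⌊N/2⌋∸2]+6 N))

ℕ→ℚ-2^ : ∀ m → 2ℚ ^ m ≡ ℕ→ℚ (2 ℕ.^ m)
ℕ→ℚ-2^ zero    = refl
ℕ→ℚ-2^ (suc m) = trans (cong (2ℚ *_) (ℕ→ℚ-2^ m)) (ℚ.toℚᵘ-injective
  (ℚᵘ.≃-trans (ℚ.toℚᵘ-homo-* 2ℚ (ℕ→ℚ (2 ℕ.^ m)))
  (*≡* (cong (ℤ._* + 1) (sym (ℤ.pos-* 2 (2 ℕ.^ m)))))))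

2^ℕ→ℚ : ∀ m → 2^ ℕ→ℚ m ≤ ℕ→ℚ (2 ℕ.^ m)
2^ℕ→ℚ m = subst (λ x → 2^ ℕ→ℚ m ≤ x) (ℕ→ℚ-2^ m)
  (^-pos 0<2 m , ℚ.≤-reflexive (sym (ℚ.*-identityʳ (2ℚ ^ m))))

-- Absorbing a constant into the error term

-- ε is 0 once r ≥ C, and cancels r before that.

vanishing-error : ∀ (C : ℚ) (x : ℕ → ℚ) (r : RealFunction) → TendsTo∞ r →
  Σ[ ε ∈ RealFunction ] (TendsTo0 ε ×
    (∀ N → .{{_ : NonZero N}} → ∀ q → lower (fromℚ (x N) -ᴿ r N +ᴿ ε N) q → q < x N - C))
vanishing-error C x r r→∞ = ε , ε→0 , bound
  where
  N₀ : ℕ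
  N₀ = proj₁ (r→∞ C)
  choose : ∀ {N} → Dec (N₀ ℕ.≤ N) → ℝ → ℝ
  choose (yes _) y = fromℚ 0ℚ
  choose (no  _) y = y -ᴿ fromℚ C
  ε : RealFunction
  ε N = choose (N₀ ℕ.≤? N) (r N)
  ε→0 : TendsTo0 ε
  ε→0 δ 0<δ = N₀ , small-error
    where
    small-error : ∀ N → .{{_ : NonZero N}} → N₀ ℕ.≤ N →
                  (fromℚ (- δ) ≤ᴿ ε N) × (ε N ≤ᴿ fromℚ δ)
    small-error N N₀≤N with N₀ ℕ.≤? N
    ... | yes _    = (λ q q<-δ → ℚ.<-trans q<-δ (ℚ.neg-antimono-< 0<δ)) , (λ q q<0 → ℚ.<-trans q<0 0<δ)
    ... | no N₀≰N  = contradiction N₀≤N N₀≰N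
  open ℚ.≤-Reasoning
  open +-*-Solver
  bound-large : ∀ x y → fromℚ C ≤ᴿ y → ∀ q → lower (fromℚ x -ᴿ y +ᴿ fromℚ 0ℚ) q → q < x - C
  bound-large x y C≤y q (a , e , (a₁ , b , a₁<x , -b>y , a<a₁+b) , e<0 , q<a+e) = begin-strict
    q           <⟨ q<a+e ⟩
    a + e       <⟨ ℚ.+-mono-< a<a₁+b e<0 ⟩
    a₁ + b + 0ℚ ≡⟨ ℚ.+-identityʳ (a₁ + b) ⟩
    a₁ + b      <⟨ ℚ.+-mono-<-≤ a₁<x b≤-C ⟩
    x - C       ∎
    where
    b≤-C : b ≤ - C
    b≤-C = subst (_≤ - C) (solve 1 (λ b → :- (:- b) := b) refl b)
      -- `- b` lies in the upper cut of `y`. If it were below `C`, then `C ≤ᴿ y` would put it in the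
      -- lower cut as well.
      (ℚ.neg-antimono-≤ (ℚ.≮⇒≥ λ -b<C → disjoint y (C≤y (- b) -b<C) -b>y))
  bound-small : ∀ x y q → lower (fromℚ x -ᴿ y +ᴿ (y -ᴿ fromℚ C)) q → q < x - C
  bound-small x y q (a , e , (a₁ , b , a₁<x , -b>y , a<a₁+b) , (b₂ , c , b₂<y , C<-c , e<b₂+c) , q<a+e) = begin-strict
    q                    <⟨ q<a+e ⟩
    a + e                <⟨ ℚ.+-mono-< a<a₁+b e<b₂+c ⟩
    -- The two copies of `y` cancel: `b₂` is in its lower cut and `- b` in its upper cut, so
    -- `b₂ < - b`.
    a₁ + b + (b₂ + c)    <⟨ ℚ.+-mono-< (ℚ.+-monoˡ-< b a₁<x) (ℚ.+-mono-< (lower<upper y b₂<y -b>y) c<-C) ⟩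
    x + b + (- b - C)    ≡⟨ solve 3 (λ x b C → x :+ b :+ (:- b :- C) := x :- C) refl x b C ⟩
    x - C                ∎
    where
    c<-C : c < - C
    c<-C = subst (_< - C) (solve 1 (λ c → :- (:- c) := c) refl c) (ℚ.neg-antimono-< C<-c)
  bound : ∀ N → .{{_ : NonZero N}} → ∀ q → lower (fromℚ (x N) -ᴿ r N +ᴿ ε N) q → q < x N - C
  bound N with N₀ ℕ.≤? N
  ... | yes N₀≤N = bound-large (x N) (r N) (proj₂ (r→∞ C) N N₀≤N)
  ... | no  _    = bound-small (x N) (r N)

-- Divergence of the logarithm

∑-++ : ∀ m n f → ∑ (m ℕ.+ n) f ≡ ∑ m f + ∑ n (f ∘ (m ℕ.+_))
∑-++ zero    n f = sym (ℚ.+-identityˡ _)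
∑-++ (suc m) n f = trans (cong (_+_ (f 0)) (∑-++ m n (f ∘ suc)))
                         (sym (ℚ.+-assoc (f 0) (∑ m (f ∘ suc)) (∑ n (f ∘ (suc m ℕ.+_)))))

∑-monoˡ-≤ : ∀ {m n} f → (∀ i → 0ℚ ≤ f i) → m ℕ.≤ n → ∑ m f ≤ ∑ n f
∑-monoˡ-≤ {n = n} f 0≤f z≤n = ∑-nonNeg n f 0≤f
  where
  ∑-nonNeg : ∀ n f → (∀ i → 0ℚ ≤ f i) → 0ℚ ≤ ∑ n f
  ∑-nonNeg zero    f 0≤f = ℚ.≤-refl
  ∑-nonNeg (suc n) f 0≤f = ℚ.+-mono-≤ (0≤f 0) (∑-nonNeg n (f ∘ suc) (0≤f ∘ suc))
∑-monoˡ-≤ f 0≤f (s≤s m≤n) = ℚ.+-monoʳ-≤ (f 0) (∑-monoˡ-≤ (f ∘ suc) (0≤f ∘ suc) m≤n)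

-- The terms of the lower Darboux sum of mesh 1, that is of `darbouxˡ N 0`.
harmonic : ℕ → ℚ
harmonic i = + 1 / (2 ℕ.+ i)

-- In closed form `2^(n+1) - 2`, so within a block the denominators `2 + i` run from one power of 2
-- up to the next.
block-end : ℕ → ℕ
block-end zero    = 0
block-end (suc n) = block-end n ℕ.+ (2 ℕ.+ block-end n)

-- Each block t ≤ i < 2t + 2 contributes at least ½.

n·½≤∑harmonic : ∀ n → n · ½ ≤ ∑ (block-end n) harmonic
n·½≤∑harmonic zero    = ℚ.≤-refl
n·½≤∑harmonic (suc n) = begin
  ½ + n · ½                                                    ≡⟨ ℚ.+-comm ½ (n · ½) ⟩
  n · ½ + ½                                                    ≤⟨ ℚ.+-mono-≤ (n·½≤∑harmonic n) block ⟩
  ∑ t harmonic + ∑ (2 ℕ.+ t) (harmonic ∘ (t ℕ.+_))             ≡⟨ ∑-++ t (2 ℕ.+ t) harmonic ⟨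
  ∑ (t ℕ.+ (2 ℕ.+ t)) harmonic                                 ∎
  where
  open ℚ.≤-Reasoning
  t : ℕ
  t = block-end n
  block : ½ ≤ ∑ (2 ℕ.+ t) (harmonic ∘ (t ℕ.+_))
  block = begin
    ½                                                ≡⟨ ·-recip (2 ℕ.+ t) 1 refl ⟨
    (2 ℕ.+ t) · (+ 1 / (2 ℕ.* (2 ℕ.+ t)))            ≤⟨ ·-∑-mono _≤_ ℚ.≤-refl ℚ.≤-trans ℚ.+-mono-≤ (2 ℕ.+ t) {f = harmonic ∘ (t ℕ.+_)}
                                                          (λ i i<2+t → recip-antimono (ℕ.s≤s⁻¹ (each i i<2+t))) ⟩
    ∑ (2 ℕ.+ t) (harmonic ∘ (t ℕ.+_))                ∎
    where
    each : ∀ i → i ℕ.< 2 ℕ.+ t → 2 ℕ.+ (t ℕ.+ i) ℕ.≤ 2 ℕ.* (2 ℕ.+ t)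
    each i i<2+t = ℕ.+-monoʳ-≤ (2 ℕ.+ t) (ℕ.≤-trans (ℕ.<⇒≤ i<2+t) (ℕ.m≤m+n (2 ℕ.+ t) 0))

-- Mesh 1 suffices: its lower Darboux sum is a harmonic sum with `N - 1` terms, which is why the
-- threshold is one more than `block-end n`.
log→∞ : TendsTo∞ (λ N → log N)
log→∞ K with archimedean K 0<½
... | n , K<n·½ = suc (block-end n) , λ { N@(suc N-1) (s≤s t≤N-1) q q<K → 0 , (begin-strict
    q                         <⟨ q<K ⟩
    K                         <⟨ K<n·½ ⟩
    n · ½                     ≤⟨ n·½≤∑harmonic n ⟩
    ∑ (block-end n) harmonic  ≤⟨ ∑-monoˡ-≤ harmonic (λ i → ℚ.<⇒≤ (recip-pos (suc i))) (subst (block-end n ℕ.≤_) (sym (ℕ.*-identityʳ N-1)) t≤N-1) ⟩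
    darbouxˡ N 0              ∎) }
  where open ℚ.≤-Reasoning

-- Assembly of the two bounds

-- The strict inequality `t < ℕ→ℚ m` lets `2^-separate` compare any `p` below `2^t` with `2^m`.
2^ᴿ-≤ : ∀ x m y → (∀ t → lower x t → t < ℕ→ℚ m) → ℕ→ℚ (2 ℕ.^ m) ≤ y → 2^ᴿ x ≤ᴿ fromℚ y
2^ᴿ-≤ x m y x≤m 2^m≤y q (t , p , tx , p≤2^t , q<p) =
  ℚ.<-≤-trans q<p (ℚ.≤-trans (2^-separate p≤2^t (x≤m t tx) (2^ℕ→ℚ m)) 2^m≤y)

theorem3 : (∀ (r : RealFunction) → TendsTo∞ r →
    Σ[ ε ∈ RealFunction ] (TendsTo0 ε ×
    (∀ (N : ℕ) → .{{_ : NonZero N}} →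
    2^ᴿ (fromℚ (+ N / 2) -ᴿ r N +ᴿ ε N) ≤ᴿ fromℚ (Eˡⁱⁿ⁻ᵉˣᵖ⁻ˢʸᵐ N))))
    ×
    (Σ[ ε ∈ RealFunction ] (TendsTo0 ε ×
    (∀ (N : ℕ) → .{{_ : NonZero N}} →
    fromℚ (+ N / 2) -ᴿ log N +ᴿ ε N ≤ᴿ fromℚ (Eˡⁱⁿ⁻ˢʸᵐ N))))
theorem3 = exponential , linear
  where
  m : ℕ → ℕ
  m N = ⌊ N /2⌋ ℕ.∸ 2
  N/2-3≤m : ∀ N → + N / 2 - 3ℚ ≤ ℕ→ℚ (m N)
  N/2-3≤m N = N≤2m+6⇒N/2-3≤m N (m N) (N≤2[⌊N/2⌋∸2]+6 N)
  exponential : ∀ (r : RealFunction) → TendsTo∞ r →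
    Σ[ ε ∈ RealFunction ] (TendsTo0 ε ×
    (∀ (N : ℕ) → .{{_ : NonZero N}} →
    2^ᴿ (fromℚ (+ N / 2) -ᴿ r N +ᴿ ε N) ≤ᴿ fromℚ (Eˡⁱⁿ⁻ᵉˣᵖ⁻ˢʸᵐ N)))
  -- With `C = 3` the error term brings the exponent down to at most `N/2 - 3`, hence to at most the
  -- integer `m N`, where the convexity bound applies.
  exponential r r→∞ = let ε , ε→0 , bound = vanishing-error 3ℚ (λ N → + N / 2) r r→∞ in ε , ε→0 , λ N →
    2^ᴿ-≤ (fromℚ (+ N / 2) -ᴿ r N +ᴿ ε N) (m N) (Eˡⁱⁿ⁻ᵉˣᵖ⁻ˢʸᵐ N)
      (λ t t<x → ℚ.<-≤-trans (bound N t t<x) (N/2-3≤m N))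
      (ℕ→ℚ-≤-𝔼 N (2 ℕ.^ m N) (λ s → 2 ℕ.^ Lˢʸᵐ s) (∑2^-jensen N (m N) Lˢʸᵐ (∑Lˢʸᵐ-lower N)))
  linear : Σ[ ε ∈ RealFunction ] (TendsTo0 ε ×
    (∀ (N : ℕ) → .{{_ : NonZero N}} →
    fromℚ (+ N / 2) -ᴿ log N +ᴿ ε N ≤ᴿ fromℚ (Eˡⁱⁿ⁻ˢʸᵐ N)))
  linear = let ε , ε→0 , bound = vanishing-error 3ℚ (λ N → + N / 2) (λ N → log N) log→∞ in ε , ε→0 , λ N q q<x →
    ℚ.<-≤-trans (bound N q q<x) (ℚ.≤-trans (N/2-3≤m N) (ℕ→ℚ-≤-𝔼 N (m N) Lˢʸᵐ (∑Lˢʸᵐ-lower N)))
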